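{- Let $r\ge 1$, let $A=\{a(1),\dots,a(r)\}$ be a set of $r$ distinct integers such that $\sum_{i=1}^{k-1}a(i)<a(k)$ for all $1\le k\le r$ and such that the $2^r-1$ sums of nonempty collections of distinct elements of $A$ are all distinct, and let $N$ be a positive integer with $N\ge a(1)+\cdots+a(r)$. For integers $n\ge 1$ and $k\ge 0$: - let $F(-A_N;k,n)$ denote the number of overpartitions of $n$ into parts taken from $-A_N$, having exactly $k$ non-overlined parts; - let $G(-A'_N;k,n)$ denote the number of overpartitions of $n$ into parts taken from $-A'_N$, of the form $n=\lambda_1+\cdots+\lambda_s$ (with $\lambda_1\ge\cdots\ge\lambda_s$), having exactly $k$ non-overlined parts, such that for all $1\le i\le s-1$ $$\lambda_i-\lambda_{i+1}\ \ge\ N\bigl(w(\beta_N(-\lambda_i))-1+\chi(\overline{\lambda_{i+1}})\bigr)+v(\beta_N(-\lambda_i))-\beta_N(-\lambda_i),$$ and $$\lambda_s\ \ge\ N\bigl(w(\beta_N(-\lambda_s))-1\bigr),$$ where $\chi(\overline{\lambda_{i+1}})=1$ if $\lambda_{i+1}$ is overlined and $0$ otherwise. Then $F(-A_N;k,n)=G(-A'_N;k,n)$ for all $n\ge1$ and $k\ge 0$.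
   Context: A partition of $n$ is a non-increasing sequence of positive integers whose sum is $n$. An overpartition of $n$ is a partition of $n$ in which the first occurrence of each number may be overlined (so among equal parts only the first listed one can be overlined). For example, $\overline{2}+2$ is an overpartition of $4$, with one non-overlined part. The numerical value of an overlined part is that of the underlying integer. Let $A'$ be the set of the $2^r-1$ sums of nonempty collections of distinct elements of $A$. Each $\alpha\in A'$ has a unique such defining sum; $w(\alpha)$ is the number of terms in the defining sum of $\alpha$, and $v(\alpha)$ is the smallest $a(i)$ appearing in it. Note that the condition for $k=1$ says $a(1)>0$. $-A_N$ is the set of positive integers congruent to $-a(i)$ modulo $N$ for some $i$, and $-A'_N$ is the set of positive integers congruent to $-\alpha$ modulo $N$ for some $\alpha\in A'$. $\beta_N(m)$ denotes the least positive residue of $m$ modulo $N$, i.e. the element of $\{1,\dots,N\}$ congruent to $m$ modulo $N$. Thus $\beta_N(-\lambda)\in A'$ for every $\lambda\in -A'_N$. -}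

module Defs where

open import Data.Bool.Base using (Bool; T; not; if_then_else_)
open import Data.Bool.Properties using (T?)
open import Data.Fin.Base using (Fin)
open import Data.Fin.Subset using (Subset; Nonempty; ∣_∣)
open import Data.Fin.Subset.Properties using (_∈?_; nonempty?; anySubset?)
open import Data.Integer.Base as ℤ using (ℤ; +_; 0ℤ; 1ℤ; -_; _+_; _-_; _*_; _≤_; _≥_; _%ℕ_)
open import Data.Integer.Divisibility using (_∣_)
import Data.Integer.Properties as ℤ
open import Data.List.Base using (List; length; map; filter; allFin; last)
open import Data.List.Extrema ℤ.≤-totalOrder using (min)
open import Data.List.Membership.Propositional using () renaming (_∈_ to _∈ₗ_)
open import Data.List.Relation.Unary.All using (All)
open import Data.List.Relation.Unary.AllPairs using (AllPairs)
open import Data.List.Relation.Unary.Linked using (Linked)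
open import Data.List.Relation.Unary.Unique.Propositional using (Unique)
open import Data.Maybe.Base using (just)
open import Data.Nat.Base as ℕ using (ℕ; zero; suc; NonZero)
open import Data.Nat.ListAction using (sum)
open import Data.Product.Base using (_×_; _,_; ∃-syntax)
open import Data.Vec.Base using (lookup)
open import Function.Bundles using (_⇔_)
open import Relation.Binary.PropositionalEquality.Core using (_≡_; _≢_)
open import Relation.Nullary using (Dec; yes; no; _×-dec_)
open import Algebra.Properties.CommutativeMonoid.Sum ℤ.+-0-commutativeMonoid public
  using (sum-syntax)

record Part : Set where
  constructor part
  field
    size      : ℕ
    overlined : Bool

open Part public

-- Parts are listed from largest to smallest.
record IsOverpartition (n : ℕ) (ps : List Part) : Set where
  field
    positive      : All (λ p → 1 ℕ.≤ size p) ps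
    nonincreasing : Linked (λ p q → size p ℕ.≥ size q) ps
    -- Only the first listed occurrence of a number may be overlined.
    firstOnly     : AllPairs (λ p q → T (overlined q) → size p ≢ size q) ps
    sums          : sum (map size ps) ≡ n

nonOverlined : List Part → ℕ
nonOverlined ps = length (filter (λ p → T? (not (overlined p))) ps)

χ : Part → ℤ
χ p = if overlined p then 1ℤ else 0ℤ

infix 4 _≡_[mod_]

_≡_[mod_] : ℤ → ℤ → ℕ → Set
x ≡ y [mod N ] = + N ∣ (x - y)

-- The least positive residue, so that multiples of N are sent to N.
β : (N : ℕ) .{{_ : NonZero N}} → ℤ → ℤ
β N m with m %ℕ N
... | zero  = + N
... | suc t = + suc t

module _ {r : ℕ} (a : Fin r → ℤ) where

  subsetSum : Subset r → ℤ
  subsetSum S = ∑[ i < r ] (if lookup S i then a i else 0ℤ)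

  A′ : ℤ → Set
  A′ α = ∃[ S ] (Nonempty S × subsetSum S ≡ α)

  A′? : ∀ α → Dec (A′ α)
  A′? α = anySubset? (λ S → nonempty? S ×-dec (subsetSum S ℤ.≟ α))

  -- For α in A′, w α is the number of terms of the defining sum of α and v α is
  -- its smallest term.  When the nonempty subset sums are distinct, the set S
  -- found by A′? is the only one with sum α.  The value off A′ is a dummy.
  w : ℤ → ℤ
  w α with A′? α
  ... | yes (S , _) = + ∣ S ∣
  ... | no _        = 0ℤ

  -- The default passed to min is itself a term of the sum, since i₀ ∈ S.
  v : ℤ → ℤ
  v α with A′? α
  ... | yes (S , (i₀ , _) , _) = min (a i₀) (map a (filter (_∈? S) (allFin r)))
  ... | no _                   = 0ℤ

  -A[_] : ℕ → ℕ → Set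
  -A[ N ] l = 1 ℕ.≤ l × ∃[ i ] (+ l ≡ - a i [mod N ])

  -A′[_] : ℕ → ℕ → Set
  -A′[ N ] l = 1 ℕ.≤ l × ∃[ α ] (A′ α × + l ≡ - α [mod N ])

  record IsF (N k n : ℕ) (ps : List Part) : Set where
    field
      overpartition : IsOverpartition n ps
      partsFrom     : All (λ p → -A[ N ] (size p)) ps
      nonOverlined≡ : nonOverlined ps ≡ k

  module _ (N : ℕ) .{{_ : NonZero N}} where

    private
      β⁻ : Part → ℤ
      β⁻ p = β N (- (+ size p))

    Gap : Part → Part → Set
    Gap p q =
      + size p - + size q ≥ + N * (w (β⁻ p) - 1ℤ + χ q) + v (β⁻ p) - β⁻ p

    LastBound : Part → Set
    LastBound p = + size p ≥ + N * (w (β⁻ p) - 1ℤ)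

    record IsG (k n : ℕ) (ps : List Part) : Set where
      field
        overpartition : IsOverpartition n ps
        partsFrom     : All (λ p → -A′[ N ] (size p)) ps
        nonOverlined≡ : nonOverlined ps ≡ k
        gaps          : Linked Gap ps
        lastBound     : ∀ p → last ps ≡ just p → LastBound p

-- Exactly m elements satisfy P: they can be listed, each exactly once, in a
-- list of length m.  Such an m is unique when it exists.
Number : {X : Set} → (X → Set) → ℕ → Set
Number P m = ∃[ xs ] (Unique xs × (∀ x → x ∈ₗ xs ⇔ P x) × length xs ≡ m)

{-# OPTIONS --safe #-}
module Submission where

-- Since a is superincreasing, v(α) > α′ says that the least index of the defining
-- sum S of α exceeds every index of that of α′.  With ρ(S) the sum over i ∈ S of
-- the representatives of -a(i) in {1,…,N}, a list of parts N xⱼ + ρ(Sⱼ) then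
-- satisfies the gap conditions iff xⱼ = vⱼ + cⱼ, where cⱼ depends on the blocks
-- Sⱼ, Sⱼ₊₁, … only and v₁, v₂, … is an overpartition with parts ≥ 0.
--
-- An overpartition into parts N t + ρ(p) with p a single index is turned into such
-- blocks and values by reading its parts one by one: the overlined ones by
-- increasing size, then the plain ones by decreasing size.  The part N t + ρ(p)
-- starts a new block {p} and contributes the value t.  If p is less than all
-- elements of the last block, all earlier values first decrease by 1; if this makes
-- an overlined 0 negative, that value is dropped and p joins the last block instead
-- of starting a new one.  The step can be undone, because the value last added is
-- the least plain value if there is one and the greatest overlined value otherwise.

open import Defs
open import Data.Bool.Base using (Bool; true; false; T; not; if_then_else_)
import Data.Bool.Properties as Bool
open import Data.Empty using (⊥)
open import Data.Fin.Base as Fin using (Fin; toℕ; inject)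
import Data.Fin.Induction as Fin
import Data.Fin.Properties as Fin
open import Data.Fin.Subset using (Subset; Nonempty; inside; outside; ∣_∣) renaming (_∈_ to _∈ₛ_)
open import Data.Fin.Subset.Properties using (_∈?_)
open import Data.Integer.Base as ℤ using (ℤ; +_; -[1+_]; 0ℤ; 1ℤ; _<_; _≤_)
open import Data.Integer.DivMod using (_%ℕ_; _/ℕ_; n%ℕd<d; a≡a%ℕn+[a/ℕn]*n)
import Data.Integer.Properties as ℤ
open import Data.Integer.Solver using () renaming (module +-*-Solver to ℤ-Solver)
open import Data.List.Base
  using (List; []; _∷_; _++_; [_]; map; length; filter; concat; reverse; last; allFin; upTo;
         cartesianProductWith; deduplicate)
open import Data.List.Extrema ℤ.≤-totalOrder using (min≈v⁺)
open import Data.List.Membership.Propositional using (_∈_; find)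
open import Data.List.Membership.Propositional.Properties
  using (∈-map⁺; ∈-allFin; ∈-upTo⁺; ∈-filter⁺; ∈-filter⁻;
         ∈-deduplicate⁺; ∈-deduplicate⁻; ∈-cartesianProductWith⁺)
open import Data.List.Properties
  using (≡-dec; ∷-injectiveˡ; ∷-injectiveʳ; ++-assoc; ++-cancelʳ; map-++; map-∘; map-injective;
         length-map; length-reverse; unfold-reverse; reverse-involutive; reverse-injective)
open import Data.List.Relation.Binary.Permutation.Propositional as Perm using (_↭_; ↭-sym; ↭-trans; prep)
import Data.List.Relation.Binary.Permutation.Propositional.Properties as Perm
open import Data.List.Relation.Unary.All as All using (All; []; _∷_)
import Data.List.Relation.Unary.All.Properties as All
open import Data.List.Relation.Unary.AllPairs as AllPairs using (AllPairs; []; _∷_)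
import Data.List.Relation.Unary.AllPairs.Properties as AllPairs
open import Data.List.Relation.Unary.Any using (here; there)
open import Data.List.Relation.Unary.Linked as Linked using (Linked; []; [-]; _∷_)
import Data.List.Relation.Unary.Linked.Properties as Linked
open import Data.List.Relation.Unary.Unique.Propositional using (Unique)
import Data.List.Relation.Unary.Unique.DecPropositional.Properties as Unique
open import Data.Maybe.Base using (just)
open import Data.Nat.Base as ℕ using (ℕ; zero; suc; pred; z≤n; s≤s; _+_; _*_; NonZero)
open import Data.Nat.Divisibility using (_∣_; divides; _∣?_; m∣m*n)
open import Data.Nat.ListAction using (sum)
open import Data.Nat.ListAction.Properties using (sum-++; sum-↭)
import Data.Nat.Properties as ℕ
open import Data.Nat.Solver using (module +-*-Solver)
open import Data.Product.Base using (Σ; _×_; _,_; ∃-syntax; proj₁; proj₂)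
open import Data.Sum.Base using (_⊎_; inj₁; inj₂)
open import Data.Unit.Base using (⊤; tt)
open import Data.Vec.Base using ([]; _∷_; here; there)
open import Function.Base using (_∘_; case_of_)
open import Function.Bundles using (_⇔_; mk⇔; Equivalence)
open import Function.Construct.Composition using (_⇔-∘_)
open import Function.Definitions using (Injective)
open import Induction.WellFounded using (Acc; acc)
open import Relation.Binary.Definitions using (DecidableEquality; Transitive; tri<; tri≈; tri>)
open import Relation.Binary.PropositionalEquality hiding ([_])
open import Relation.Nullary using (¬_; Dec; yes; no; does; contradiction)
open import Relation.Nullary.Decidable using (dec-true; dec-false; map′; _×-dec_)
open import Relation.Unary using (Decidable)

-- Counting along bijections given as relations.

-- A bijection encoded as a relation: below it is "is a rearrangement of" or the inductive
-- `Stacked`, for which no map in either direction has to be computed.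
record _≃_ {X Y : Set} (P : X → Set) (Q : Y → Set) : Set₁ where
  infix 4 _~_
  field
    _~_        : X → Y → Set
    total      : ∀ {x} → P x → ∃[ y ] (Q y × x ~ y)
    surjective : ∀ {y} → Q y → ∃[ x ] (P x × x ~ y)
    functional : ∀ {x y y′} → Q y → Q y′ → x ~ y → x ~ y′ → y ≡ y′
    injective  : ∀ {x x′ y} → P x → P x′ → x ~ y → x′ ~ y → x ≡ x′

module _ {X Y : Set} {P : X → Set} {Q : Y → Set} (P≃Q : P ≃ Q) where
  open _≃_ P≃Q

  private
    -- The partners are collected with a matching in both directions. With injectivity the backward
    -- matching keeps the new list free of repetitions. With surjectivity and functionality the
    -- forward one shows that no element of `Q` is missed.
    transport : ∀ xs → All P xs → Unique xs →
      ∃[ ys ] (Unique ys × All Q ys × length ys ≡ length xs ×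
               (∀ {y} → y ∈ ys → ∃[ x ] (x ∈ xs × x ~ y)) ×
               (∀ {x} → x ∈ xs → ∃[ y ] (y ∈ ys × x ~ y)))
    transport [] [] [] = [] , [] , [] , refl , (λ ()) , (λ ())
    transport (x ∷ xs) (px ∷ pxs) (x∉xs ∷ xs!)
      with y , qy , x~y ← total px
      with ys , ys! , qys , len , back , forth ← transport xs pxs xs! =
        y ∷ ys , All.tabulate y∉ys ∷ ys! , qy ∷ qys , cong suc len , back′ , forth′
      where
      y∉ys : ∀ {y′} → y′ ∈ ys → y ≢ y′
      y∉ys y∈ refl with x′ , x′∈ , x′~y ← back y∈ =
        All.lookup x∉xs x′∈ (injective px (All.lookup pxs x′∈) x~y x′~y)
      back′ : ∀ {y′} → y′ ∈ y ∷ ys → ∃[ x′ ] (x′ ∈ x ∷ xs × x′ ~ y′)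
      back′ (here refl) = x , here refl , x~y
      back′ (there y∈) with x′ , x′∈ , r ← back y∈ = x′ , there x′∈ , r
      forth′ : ∀ {x′} → x′ ∈ x ∷ xs → ∃[ y′ ] (y′ ∈ y ∷ ys × x′ ~ y′)
      forth′ (here refl) = y , here refl , x~y
      forth′ (there x∈) with y′ , y′∈ , r ← forth x∈ = y′ , there y′∈ , r

  Number-≃ : ∀ {m} → Number P m → Number Q m
  Number-≃ (xs , xs! , xs⇔P , len)
    with ys , ys! , qys , len′ , back , forth ←
           transport xs (All.tabulate (λ {x} → Equivalence.to (xs⇔P x))) xs! =
      ys , ys! , (λ y → mk⇔ (All.lookup qys) from) , trans len′ len
    where
    from : ∀ {y} → Q y → y ∈ ys
    from qy with x , px , x~y ← surjective qy
            with y′ , y′∈ , x~y′ ← forth (Equivalence.from (xs⇔P x) px)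
            rewrite functional qy (All.lookup qys y′∈) x~y x~y′ = y′∈

Number-⇔ : {X : Set} {P Q : X → Set} → (∀ x → P x ⇔ Q x) → ∀ {m} → Number P m → Number Q m
Number-⇔ P⇔Q (xs , xs! , xs⇔P , len) = xs , xs! , (λ x → P⇔Q x ⇔-∘ xs⇔P x) , len

module _ {X : Set} (_≟_ : DecidableEquality X) {P : X → Set} (P? : Decidable P) where

  -- The theorem asserts that a count exists, so finiteness has to be shown. A decidable property
  -- confined to a known list is enumerated by filtering that list and removing repetitions.
  number-⊆ : ∀ xs → (∀ {x} → P x → x ∈ xs) → ∃[ m ] Number P m
  number-⊆ xs P⊆xs = _ , ys , Unique.deduplicate-! _≟_ (filter P? xs) , (λ x → mk⇔ to from) , refl
    where
    ys = deduplicate _≟_ (filter P? xs)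
    to : ∀ {x} → x ∈ ys → P x
    to x∈ = proj₂ (∈-filter⁻ P? {xs = xs} (∈-deduplicate⁻ _≟_ (filter P? xs) x∈))
    from : ∀ {x} → P x → x ∈ ys
    from px = ∈-deduplicate⁺ _≟_ (∈-filter⁺ P? (P⊆xs px) px)

-- Reorderings of a list of parts

Plain : Part → Set
Plain p = T (not (overlined p))

_≟ₚ_ : DecidableEquality Part
part s o ≟ₚ part t o′ with s ℕ.≟ t | o Bool.≟ o′
... | yes refl | yes refl = yes refl
... | no s≢t   | _        = no λ where refl → s≢t refl
... | yes _    | no o≢o′  = no λ where refl → o≢o′ refl

OnlyPlainRepeats : List Part → Set
OnlyPlainRepeats = AllPairs (λ p q → p ≡ q → Plain p)

-- A total order that is reflexive exactly at the plain parts. Linked lists are then the sorted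
-- lists in which only plain parts repeat.
record PartOrder (_<_ : Part → Part → Set) : Set where
  field
    <-trans   : Transitive _<_
    <-antisym : ∀ {p q} → p < q → q < p → p ≡ q
    <-connex  : ∀ p q → p < q ⊎ q < p ⊎ p ≡ q
    plain⇒<   : ∀ p → Plain p → p < p
    <⇒plain   : ∀ p → p < p → Plain p

  linked⇒onlyPlainRepeats : ∀ {ps} → Linked _<_ ps → OnlyPlainRepeats ps
  linked⇒onlyPlainRepeats l =
    AllPairs.map (λ where p<q refl → <⇒plain _ p<q) (Linked.Linked⇒AllPairs <-trans l)

  private
    insert : ∀ p qs → AllPairs _<_ qs → All (λ q → p ≡ q → Plain p) qs →
             ∃[ rs ] (p ∷ qs ↭ rs × AllPairs _<_ rs)
    insert p [] [] [] = p ∷ [] , Perm.refl , [] ∷ []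
    insert p (q ∷ qs) (q< ∷ qs<) (d ∷ ds) with <-connex p q
    ... | inj₁ p<q = _ , Perm.refl , (p<q ∷ All.map (<-trans p<q) q<) ∷ (q< ∷ qs<)
    ... | inj₂ (inj₂ refl) = _ , Perm.refl , (plain⇒< p (d refl) ∷ q<) ∷ (q< ∷ qs<)
    ... | inj₂ (inj₁ q<p) with rs , π , rs< ← insert p qs qs< ds =
      q ∷ rs , ↭-trans (Perm.swap p q Perm.refl) (prep q π) , Perm.All-resp-↭ π (q<p ∷ q<) ∷ rs<

    sort′ : ∀ ps → OnlyPlainRepeats ps → ∃[ qs ] (ps ↭ qs × AllPairs _<_ qs)
    sort′ [] [] = [] , Perm.refl , []
    sort′ (p ∷ ps) (d ∷ ds) with qs , π , qs< ← sort′ ps ds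
                            with rs , ρ , rs< ← insert p qs qs< (Perm.All-resp-↭ π d) =
      rs , ↭-trans (prep p π) ρ , rs<

    unique : ∀ {ps qs} → AllPairs _<_ ps → AllPairs _<_ qs → ps ↭ qs → ps ≡ qs
    unique {[]} _ _ π = sym (Perm.↭-empty-inv (↭-sym π))
    unique {p ∷ ps} {[]} _ _ π = Perm.↭-empty-inv π
    unique {p ∷ ps} {q ∷ qs} (p< ∷ ps<) (q< ∷ qs<) π = helper p≡q π
      where
      p≡q : p ≡ q
      p≡q with Perm.∈-resp-↭ π (here refl) | Perm.∈-resp-↭ (↭-sym π) (here refl)
      ... | here refl | _ = refl
      ... | there _ | here refl = refl
      ... | there p∈ | there q∈ = <-antisym (All.lookup p< q∈) (All.lookup q< p∈)
      helper : p ≡ q → p ∷ ps ↭ q ∷ qs → p ∷ ps ≡ q ∷ qs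
      helper refl π = cong (p ∷_) (unique ps< qs< (Perm.drop-∷ π))

  -- Together with `sorted-unique` this gives each multiset in which only plain parts repeat exactly
  -- one arrangement per order. Passing from one order to another is therefore a bijection.
  sort : ∀ {ps} → OnlyPlainRepeats ps → ∃[ qs ] (ps ↭ qs × Linked _<_ qs)
  sort d with qs , π , qs< ← sort′ _ d = qs , π , Linked.AllPairs⇒Linked qs<

  sorted-unique : ∀ {ps qs} → Linked _<_ ps → Linked _<_ qs → ps ↭ qs → ps ≡ qs
  sorted-unique l l′ = unique (Linked.Linked⇒AllPairs <-trans l) (Linked.Linked⇒AllPairs <-trans l′)

-- The order in which an overpartition is listed. An overlined `q` needs a strict descent, because
-- it must be the first occurrence of its size.
_≻_ : Part → Part → Set
p ≻ part t false = t ℕ.≤ size p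
p ≻ part t true  = t ℕ.< size p

-- The order in which parts leave the stack in the bijection below: plain parts
-- first, increasing, then overlined ones, decreasing.
_⋖_ : Part → Part → Set
part s false ⋖ part t false = s ℕ.≤ t
part s false ⋖ part t true  = ⊤
part s true  ⋖ part t false = ⊥
part s true  ⋖ part t true  = t ℕ.< s

≻-partOrder : PartOrder _≻_
≻-partOrder = record
  { <-trans = λ {p q r} → ≻-trans p q r ; <-antisym = λ {p q} → ≻-antisym p q ; <-connex = ≻-connex
  ; plain⇒< = λ where (part _ false) _ → ℕ.≤-refl
  ; <⇒plain = λ where
      (part _ false) _ → tt
      (part _ true) s<s → ℕ.<-irrefl refl s<s }
  where
  ≻-trans : ∀ p q r → p ≻ q → q ≻ r → p ≻ r
  ≻-trans p (part _ false) (part _ false) p≻q q≻r = ℕ.≤-trans q≻r p≻q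
  ≻-trans p (part _ false) (part _ true)  p≻q q≻r = ℕ.≤-trans q≻r p≻q
  ≻-trans p (part _ true)  (part _ false) p≻q q≻r = ℕ.≤-trans q≻r (ℕ.<⇒≤ p≻q)
  ≻-trans p (part _ true)  (part _ true)  p≻q q≻r = ℕ.<-trans q≻r p≻q
  ≻-antisym : ∀ p q → p ≻ q → q ≻ p → p ≡ q
  ≻-antisym (part _ false) (part _ false) a b = cong (λ s → part s false) (ℕ.≤-antisym b a)
  ≻-antisym (part _ false) (part _ true)  a b = contradiction b (ℕ.<⇒≱ a)
  ≻-antisym (part _ true)  (part _ false) a b = contradiction a (ℕ.<⇒≱ b)
  ≻-antisym (part _ true)  (part _ true)  a b = contradiction a (ℕ.<-asym b)
  ≻-connex : ∀ p q → p ≻ q ⊎ q ≻ p ⊎ p ≡ q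
  ≻-connex (part s o) (part t false) with ℕ.≤-total t s
  ... | inj₁ t≤s = inj₁ t≤s
  ≻-connex (part s false) (part t false) | inj₂ s≤t = inj₂ (inj₁ s≤t)
  ≻-connex (part s true) (part t false)  | inj₂ s≤t with ℕ.m≤n⇒m<n∨m≡n s≤t
  ... | inj₁ s<t  = inj₂ (inj₁ s<t)
  ... | inj₂ refl = inj₁ ℕ.≤-refl
  ≻-connex (part s false) (part t true) with ℕ.<-≤-connex t s
  ... | inj₁ t<s = inj₁ t<s
  ... | inj₂ s≤t = inj₂ (inj₁ s≤t)
  ≻-connex (part s true) (part t true) with ℕ.<-cmp s t
  ... | tri< s<t _ _  = inj₂ (inj₁ s<t)
  ... | tri≈ _ refl _ = inj₂ (inj₂ refl)
  ... | tri> _ _ t<s  = inj₁ t<s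

⋖-partOrder : PartOrder _⋖_
⋖-partOrder = record
  { <-trans = λ {p q r} → ⋖-trans p q r ; <-antisym = λ {p q} → ⋖-antisym p q ; <-connex = ⋖-connex
  ; plain⇒< = λ where (part _ false) _ → ℕ.≤-refl
  ; <⇒plain = λ where
      (part _ false) _ → tt
      (part _ true) s<s → ℕ.<-irrefl refl s<s }
  where
  ⋖-trans : ∀ p q r → p ⋖ q → q ⋖ r → p ⋖ r
  ⋖-trans (part _ false) (part _ false) (part _ false) a b = ℕ.≤-trans a b
  ⋖-trans (part _ false) (part _ _)     (part _ true)  a b = tt
  ⋖-trans (part _ true)  (part _ true)  (part _ true)  a b = ℕ.<-trans b a
  ⋖-antisym : ∀ p q → p ⋖ q → q ⋖ p → p ≡ q
  ⋖-antisym (part _ false) (part _ false) a b = cong (λ s → part s false) (ℕ.≤-antisym a b)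
  ⋖-antisym (part _ true)  (part _ true)  a b = contradiction a (ℕ.<-asym b)
  ⋖-connex : ∀ p q → p ⋖ q ⊎ q ⋖ p ⊎ p ≡ q
  ⋖-connex (part s false) (part t false) with ℕ.≤-total s t
  ... | inj₁ s≤t = inj₁ s≤t
  ... | inj₂ t≤s = inj₂ (inj₁ t≤s)
  ⋖-connex (part s false) (part t true) = inj₁ tt
  ⋖-connex (part s true) (part t false) = inj₂ (inj₁ tt)
  ⋖-connex (part s true) (part t true) with ℕ.<-cmp s t
  ... | tri< s<t _ _  = inj₂ (inj₁ s<t)
  ... | tri≈ _ refl _ = inj₂ (inj₂ refl)
  ... | tri> _ _ t<s  = inj₁ t<s

total-size : List Part → ℕ
total-size = sum ∘ map size

total-size-↭ : ∀ {ps qs} → ps ↭ qs → total-size ps ≡ total-size qs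
total-size-↭ π = sum-↭ (Perm.map⁺ size π)

nonOverlined-↭ : ∀ {ps qs} → ps ↭ qs → nonOverlined ps ≡ nonOverlined qs
nonOverlined-↭ π = Perm.↭-length (Perm.filter-↭ _ π)

module _ {n : ℕ} {ps : List Part} (o : IsOverpartition n ps) where
  open IsOverpartition o

  -- Between neighbours the two order conditions of an overpartition combine to `_≻_`. By
  -- transitivity nothing is lost in the converse below.
  overpartition⇒linked : Linked _≻_ ps
  overpartition⇒linked = go nonincreasing firstOnly
    where
    go : ∀ {ps} → Linked (λ p q → size p ℕ.≥ size q) ps →
         AllPairs (λ p q → T (overlined q) → size p ≢ size q) ps → Linked _≻_ ps
    go [] _ = []
    go [-] _ = [-]
    go {p ∷ part t false ∷ _} (t≤s ∷ l) (_ ∷ d) = t≤s ∷ go l d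
    go {p ∷ part t true ∷ _} (t≤s ∷ l) ((s≢t ∷ _) ∷ d) = ℕ.≤∧≢⇒< t≤s (s≢t tt ∘ sym) ∷ go l d

linked⇒overpartition : ∀ {n ps} → All (λ p → 1 ℕ.≤ size p) ps → Linked _≻_ ps →
                       total-size ps ≡ n → IsOverpartition n ps
linked⇒overpartition pos l s = record
  { positive = pos
  ; nonincreasing = Linked.map (λ {p q} → weaken p q) l
  ; firstOnly = AllPairs.map (λ {p q} → strict p q)
                  (Linked.Linked⇒AllPairs (λ {p q r} → PartOrder.<-trans ≻-partOrder {p} {q} {r}) l)
  ; sums = s }
  where
  weaken : ∀ p q → p ≻ q → size q ℕ.≤ size p
  weaken p (part _ false) = λ t≤s → t≤s
  weaken p (part _ true)  = ℕ.<⇒≤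
  strict : ∀ p q → p ≻ q → T (overlined q) → size p ≢ size q
  strict p (part _ true) t<s _ refl = ℕ.<-irrefl refl t<s

-- A finite list containing all overpartitions of n.

module _ {A : Set} (xs : List A) where

  listsUpTo : ℕ → List (List A)
  listsUpTo zero    = [] ∷ []
  listsUpTo (suc l) = [] ∷ cartesianProductWith _∷_ xs (listsUpTo l)

  ∈-listsUpTo : ∀ {l ys} → All (_∈ xs) ys → length ys ℕ.≤ l → ys ∈ listsUpTo l
  ∈-listsUpTo {zero}  []          _         = here refl
  ∈-listsUpTo {suc l} []          _         = here refl
  ∈-listsUpTo {suc l} (y∈ ∷ ys∈) (s≤s len) = there (∈-cartesianProductWith⁺ _∷_ y∈ (∈-listsUpTo ys∈ len))

overpartitionCandidates : ℕ → List (List Part)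
overpartitionCandidates n = listsUpTo (cartesianProductWith part (upTo (suc n)) (true ∷ false ∷ [])) n

-- Positive parts with sum n are at most n in size and at most n in number.
∈-overpartitionCandidates : ∀ {n ps} → IsOverpartition n ps → ps ∈ overpartitionCandidates n
∈-overpartitionCandidates o with refl ← IsOverpartition.sums o =
  ∈-listsUpTo _ (parts∈ ℕ.≤-refl) (short positive)
  where
  open IsOverpartition o using (positive)
  bool∈ : ∀ o → o ∈ true ∷ false ∷ []
  bool∈ true  = here refl
  bool∈ false = there (here refl)
  parts∈ : ∀ {n ps} → total-size ps ℕ.≤ n →
           All (_∈ cartesianProductWith part (upTo (suc n)) (true ∷ false ∷ [])) ps
  parts∈ {ps = []} _ = []
  parts∈ {ps = part s o ∷ ps} le =
    ∈-cartesianProductWith⁺ part (∈-upTo⁺ (s≤s (ℕ.m+n≤o⇒m≤o s le))) (bool∈ o) ∷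
    parts∈ (ℕ.m+n≤o⇒n≤o s le)
  short : ∀ {ps} → All (λ p → 1 ℕ.≤ size p) ps → length ps ℕ.≤ total-size ps
  short [] = z≤n
  short (1≤s ∷ pos) = ℕ.+-mono-≤ 1≤s (short pos)

-- Reading words of letters onto a stack

raise : Part → Part
raise (part s o) = part (suc s) o

overlined₀ : Part
overlined₀ = part 0 true

raise-injective : ∀ {p q} → raise p ≡ raise q → p ≡ q
raise-injective {part _ _} {part _ _} refl = refl

raise-⋖ : ∀ p q → p ⋖ q → raise p ⋖ raise q
raise-⋖ (part _ false) (part _ false) = s≤s
raise-⋖ (part _ false) (part _ true) _ = tt
raise-⋖ (part _ true)  (part _ true) = s≤s

raise-⋖⁻ : ∀ p q → raise p ⋖ raise q → p ⋖ q
raise-⋖⁻ (part _ false) (part _ false) = ℕ.s≤s⁻¹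
raise-⋖⁻ (part _ false) (part _ true) _ = tt
raise-⋖⁻ (part _ true)  (part _ true) = ℕ.s≤s⁻¹

raise-⋖-overlined₀ : ∀ p → raise p ⋖ overlined₀
raise-⋖-overlined₀ (part _ false) = tt
raise-⋖-overlined₀ (part _ true)  = s≤s z≤n

linked-raise : ∀ {V} → Linked _⋖_ V → Linked _⋖_ (map raise V)
linked-raise = Linked.map⁺ ∘ Linked.map (raise-⋖ _ _)

linked-raise-∷ʳ : ∀ {v V} → Linked _⋖_ (v ∷ V) →
                  Linked _⋖_ (raise v ∷ map raise V ++ [ overlined₀ ])
linked-raise-∷ʳ [-]       = raise-⋖-overlined₀ _ ∷ [-]
linked-raise-∷ʳ (v⋖w ∷ l) = raise-⋖ _ _ v⋖w ∷ linked-raise-∷ʳ l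

-- A plain 0 cannot occur: `raise v ⋖ u` makes a plain `u` positive, and the plain values only grow
-- from there. The overlined values decrease strictly, so an overlined 0 can only stand at the very
-- end.
lower : ∀ v {u U} → raise v ⋖ u → Linked _⋖_ (u ∷ U) →
  ∃[ V ] (Linked _⋖_ (v ∷ V) × (u ∷ U ≡ map raise V ⊎ u ∷ U ≡ map raise V ++ [ overlined₀ ]))
lower (part _ false) {part zero false} ()
lower (part _ true)  {part zero false} ()
lower v {part zero true} {[]} v⋖u l = [] , [-] , inj₂ refl
lower v {part zero true} {part _ false ∷ _} v⋖u (() ∷ _)
lower v {part zero true} {part _ true ∷ _} v⋖u (() ∷ _)
lower v {part (suc s) o} {[]} v⋖u l = [ part s o ] , raise-⋖⁻ v (part s o) v⋖u ∷ [-] , inj₁ refl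
lower v {part (suc s) o} {_ ∷ _} v⋖u (u⋖ ∷ l) with lower (part s o) u⋖ l
... | V , l′ , inj₁ eq = part s o ∷ V , raise-⋖⁻ v (part s o) v⋖u ∷ l′ , inj₁ (cong (_ ∷_) eq)
... | V , l′ , inj₂ eq = part s o ∷ V , raise-⋖⁻ v (part s o) v⋖u ∷ l′ , inj₂ (cong (_ ∷_) eq)

-- Raised values are positive, so they cannot end in a 0. This separates `descent` from `merge`.
raise≢raise∷ʳoverlined₀ : ∀ V V′ → map raise V ≢ map raise V′ ++ [ overlined₀ ]
raise≢raise∷ʳoverlined₀ (part _ _ ∷ [])    []       ()
raise≢raise∷ʳoverlined₀ (part _ _ ∷ _ ∷ _) []       ()
raise≢raise∷ʳoverlined₀ (_ ∷ V) (_ ∷ V′) eq = raise≢raise∷ʳoverlined₀ V V′ (∷-injectiveʳ eq)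

total-size-raise : ∀ V → total-size (map raise V) ≡ length V + total-size V
total-size-raise [] = refl
total-size-raise (part s _ ∷ V) rewrite total-size-raise V =
  cong suc (solve 3 (λ s l t → s :+ (l :+ t) := l :+ (s :+ t)) refl s (length V) (total-size V))
  where open +-*-Solver

total-size-raise-∷ʳ : ∀ V → total-size (map raise V ++ [ overlined₀ ]) ≡ length V + total-size V
total-size-raise-∷ʳ [] = refl
total-size-raise-∷ʳ (part s _ ∷ V) rewrite total-size-raise-∷ʳ V =
  cong suc (solve 3 (λ s l t → s :+ (l :+ t) := l :+ (s :+ t)) refl s (length V) (total-size V))
  where open +-*-Solver

nonOverlined-∷ : ∀ p {ps qs} → nonOverlined ps ≡ nonOverlined qs → nonOverlined (p ∷ ps) ≡ nonOverlined (p ∷ qs)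
nonOverlined-∷ (part _ false) = cong suc
nonOverlined-∷ (part _ true)  = λ eq → eq

nonOverlined-raise : ∀ V → nonOverlined (map raise V) ≡ nonOverlined V
nonOverlined-raise [] = refl
nonOverlined-raise (part _ false ∷ V) = cong suc (nonOverlined-raise V)
nonOverlined-raise (part _ true ∷ V)  = nonOverlined-raise V

nonOverlined-raise-∷ʳ : ∀ V → nonOverlined (map raise V ++ [ overlined₀ ]) ≡ nonOverlined V
nonOverlined-raise-∷ʳ [] = refl
nonOverlined-raise-∷ʳ (part _ false ∷ V) = cong suc (nonOverlined-raise-∷ʳ V)
nonOverlined-raise-∷ʳ (part _ true ∷ V)  = nonOverlined-raise-∷ʳ V

module _ {r : ℕ} where

  Letter : Set
  Letter = Fin r × Part

  -- A nonempty set of indices as an increasing list, standing for the sum of the corresponding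
  -- a(i). Its head is the index of the smallest term.
  Block : List (Fin r) → Set
  Block []      = ⊥
  Block (p ∷ S) = AllPairs Fin._<_ (p ∷ S)

  -- This is 1 iff v(α) > α′ for α and α′ the sums over the first and second argument.
  jump : List (Fin r) → List (Fin r) → ℕ
  jump []      S = 0
  jump (q ∷ _) S = if does (All.all? (Fin._<? q) S) then 1 else 0

  -- The sum of all cⱼ, accumulated from the last block: this block adds
  -- `jump S′ S + pred (length S)` to the cⱼ of every other block.
  cost : List (List (Fin r)) → ℕ
  cost []           = 0
  cost (S ∷ [])     = 0
  cost (S ∷ S′ ∷ B) = length (S′ ∷ B) * (jump S′ S + pred (length S)) + cost (S′ ∷ B)

  infix 4 _◁_
  -- The order `_⋖_` of the parts N t + ρ(p), expressed by indices and values alone. Since ρ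
  -- decreases and takes values in {1,...,N}, sizes compare by t first, and for equal t the smaller
  -- index has the larger size.
  _◁_ : Letter → Letter → Set
  (p , v) ◁ (q , u) = (p Fin.< q → raise v ⋖ u) × (¬ p Fin.< q → v ⋖ u)

  -- Words are read from the right, so the heads of W, B and V are the letter read
  -- last, the last block and the value added last.
  data Stacked : List Letter → List (List (Fin r)) → List Part → Set where
    empty   : Stacked [] [] []
    single  : ∀ {p v} → Stacked [ p , v ] [ [ p ] ] [ v ]
    ascent  : ∀ {p q v W S B V} → ¬ p Fin.< q →
              Stacked W ((q ∷ S) ∷ B) V →
              Stacked ((p , v) ∷ W) ([ p ] ∷ (q ∷ S) ∷ B) (v ∷ V)
    descent : ∀ {p q v W S B V} → p Fin.< q →
              Stacked W ((q ∷ S) ∷ B) (map raise V) →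
              Stacked ((p , v) ∷ W) ([ p ] ∷ (q ∷ S) ∷ B) (v ∷ V)
    merge   : ∀ {p q v W S B V} → p Fin.< q →
              Stacked W ((q ∷ S) ∷ B) (map raise V ++ [ overlined₀ ]) →
              Stacked ((p , v) ∷ W) ((p ∷ q ∷ S) ∷ B) (v ∷ V)

  -- Whichever rule was applied, the letter read last is visible at the heads of the blocks and the
  -- values. This is what allows a step to be undone.
  stacked-head : ∀ {p v W B V} → Stacked ((p , v) ∷ W) B V →
                 ∃[ S ] ∃[ B′ ] ∃[ V′ ] (B ≡ (p ∷ S) ∷ B′ × V ≡ v ∷ V′)
  stacked-head single        = _ , _ , _ , refl , refl
  stacked-head (ascent _ _)  = _ , _ , _ , refl , refl
  stacked-head (descent _ _) = _ , _ , _ , refl , refl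
  stacked-head (merge _ _)   = _ , _ , _ , refl , refl

  stacked-functional : ∀ {W B B′ V V′} → Stacked W B V → Stacked W B′ V′ → B ≡ B′ × V ≡ V′
  stacked-functional empty empty = refl , refl
  stacked-functional single single = refl , refl
  stacked-functional single (ascent _ ())
  stacked-functional single (descent _ ())
  stacked-functional single (merge _ ())
  stacked-functional (ascent _ ()) single
  stacked-functional (descent _ ()) single
  stacked-functional (merge _ ()) single
  stacked-functional (ascent _ s) (ascent _ s′) with refl , refl ← stacked-functional s s′ = refl , refl
  stacked-functional (ascent p≮q s) (descent p<q s′) with refl , _ ← stacked-functional s s′ = contradiction p<q p≮q
  stacked-functional (ascent p≮q s) (merge p<q s′) with refl , _ ← stacked-functional s s′ = contradiction p<q p≮q
  stacked-functional (descent p<q s) (ascent p≮q s′) with refl , _ ← stacked-functional s s′ = contradiction p<q p≮q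
  stacked-functional (merge p<q s) (ascent p≮q s′) with refl , _ ← stacked-functional s s′ = contradiction p<q p≮q
  stacked-functional (descent _ s) (descent _ s′) with refl , eq ← stacked-functional s s′ =
    refl , cong (_ ∷_) (map-injective raise-injective eq)
  stacked-functional (merge _ s) (merge _ s′) with refl , eq ← stacked-functional s s′ =
    refl , cong (_ ∷_) (map-injective raise-injective (++-cancelʳ _ _ _ eq))
  stacked-functional (descent _ s) (merge _ s′) =
    contradiction (proj₂ (stacked-functional s s′)) (raise≢raise∷ʳoverlined₀ _ _)
  stacked-functional (merge _ s) (descent _ s′) =
    contradiction (sym (proj₂ (stacked-functional s s′))) (raise≢raise∷ʳoverlined₀ _ _)

  -- The blocks reveal the last rule. Two or more indices in the last block mean `merge`; a single
  -- index `p` above another block means `descent` or `ascent`, according to whether `p` is less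
  -- than the head of that block.
  stacked-injective : ∀ {W W′ B V} → Stacked W B V → Stacked W′ B V → W ≡ W′
  stacked-injective empty empty = refl
  stacked-injective single single = refl
  stacked-injective (ascent _ s) (ascent _ s′) = cong (_ ∷_) (stacked-injective s s′)
  stacked-injective (descent _ s) (descent _ s′) = cong (_ ∷_) (stacked-injective s s′)
  stacked-injective (merge _ s) (merge _ s′) = cong (_ ∷_) (stacked-injective s s′)
  stacked-injective (ascent p≮q _) (descent p<q _) = contradiction p<q p≮q
  stacked-injective (descent p<q _) (ascent p≮q _) = contradiction p<q p≮q

  length-∷ʳ-raise : ∀ V → length (map raise V ++ [ overlined₀ ]) ≡ suc (length V)
  length-∷ʳ-raise [] = refl
  length-∷ʳ-raise (_ ∷ V) = cong suc (length-∷ʳ-raise V)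

  stacked-length : ∀ {W B V} → Stacked W B V → length V ≡ length B
  stacked-length empty = refl
  stacked-length single = refl
  stacked-length (ascent _ s) = cong suc (stacked-length s)
  stacked-length (descent {V = V} _ s) = cong suc (trans (sym (length-map raise V)) (stacked-length s))
  stacked-length (merge {V = V} _ s) = trans (sym (length-∷ʳ-raise V)) (stacked-length s)

  record State (B : List (List (Fin r))) (V : List Part) : Set where
    constructor state
    field
      blocks      : All Block B
      sameLength  : length V ≡ length B
      values      : Linked _⋖_ V

  -- The second half of `_◁_` keeps the values sorted in an `ascent`. The first half is the
  -- hypothesis of `lower`, whose two outcomes are `descent` and `merge`.
  stack : ∀ W → Linked _◁_ W → ∃[ B ] ∃[ V ] (State B V × Stacked W B V)
  stack [] [] = [] , [] , state [] refl [] , empty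
  stack ((p , v) ∷ []) [-] = _ , _ , state (([] ∷ []) ∷ []) refl [-] , single
  stack ((p , v) ∷ (q , u) ∷ W) ((lt , ge) ∷ l)
    with _ , _ , state bs len vs , s ← stack ((q , u) ∷ W) l
    with S , B , U , refl , refl ← stacked-head s
    with p Fin.<? q
  ... | no p≮q = _ , _ , state (([] ∷ []) ∷ bs) (cong suc len) (ge p≮q ∷ vs) , ascent p≮q s
  ... | yes p<q with lower v (lt p<q) vs
  ...   | V , vs′ , inj₁ eq = _ , v ∷ V ,
          state (([] ∷ []) ∷ bs) (cong suc (trans (sym (trans (cong length eq) (length-map raise V))) len)) vs′ ,
          descent p<q (subst (Stacked _ _) eq s)
  ...   | V , vs′ , inj₂ eq with b@(q< ∷ _) ∷ bs′ ← bs =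
          _ , v ∷ V ,
          state (((p<q ∷ All.map (Fin.<-trans p<q) q<) ∷ b) ∷ bs′)
                (trans (sym (trans (cong length eq) (length-∷ʳ-raise V))) len) vs′ ,
          merge p<q (subst (Stacked _ _) eq s)

  -- Each call takes one index off the blocks. When this undoes a decrease, the remaining values are
  -- raised again, and after a `merge` the dropped overlined 0 is put back at their end.
  unstack : ∀ S B V → State (S ∷ B) V → ∃[ W ] (Linked _◁_ W × Stacked W (S ∷ B) V)
  unstack [] B V (state (() ∷ _) _ _)
  unstack (p ∷ S) ([] ∷ B) V (state (_ ∷ () ∷ _) _ _)
  unstack (p ∷ []) [] (v ∷ []) _ = [ p , v ] , [-] , single
  unstack (p ∷ []) ((q ∷ S) ∷ B) (v ∷ u ∷ V) (state (_ ∷ bs) len (v⋖u ∷ vs)) with p Fin.<? q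
  ... | no p≮q with unstack (q ∷ S) B (u ∷ V) (state bs (ℕ.suc-injective len) vs)
  ...   | (q , u) ∷ W , l , s with _ , _ , _ , refl , refl ← stacked-head s =
          _ , ((λ p<q → contradiction p<q p≮q) , λ _ → v⋖u) ∷ l , ascent p≮q s
  unstack (p ∷ []) ((q ∷ S) ∷ B) (v ∷ u ∷ V) (state (_ ∷ bs) len (v⋖u ∷ vs)) | yes p<q
    with unstack (q ∷ S) B (map raise (u ∷ V))
           (state bs (trans (length-map raise (u ∷ V)) (ℕ.suc-injective len)) (linked-raise vs))
  ... | (q , _) ∷ W , l , s with _ , _ , _ , refl , refl ← stacked-head s =
    _ , ((λ _ → raise-⋖ _ _ v⋖u) , contradiction p<q) ∷ l , descent p<q s
  unstack (p ∷ q ∷ S) B (v ∷ V) (state (((p<q ∷ _) ∷ b) ∷ bs) len vs)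
    with unstack (q ∷ S) B (map raise V ++ [ overlined₀ ])
           (state (b ∷ bs) (trans (length-∷ʳ-raise V) len) (Linked.tail (linked-raise-∷ʳ vs)))
  ... | [] , _ , ()
  ... | (q , _) ∷ W , l , s with _ , _ , _ , refl , eq ← stacked-head s =
    _ , ((λ _ → Linked.head (subst (λ U → Linked _⋖_ (raise v ∷ U)) eq (linked-raise-∷ʳ vs))) ,
         contradiction p<q) ∷ l ,
    merge p<q s

  stacked-colors : ∀ {W B V} → Stacked W B V → map proj₁ W ≡ concat B
  stacked-colors empty = refl
  stacked-colors single = refl
  stacked-colors (ascent _ s) = cong (_ ∷_) (stacked-colors s)
  stacked-colors (descent _ s) = cong (_ ∷_) (stacked-colors s)
  stacked-colors (merge _ s) = cong (_ ∷_) (stacked-colors s)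

  stacked-nonOverlined : ∀ {W B V} → Stacked W B V → nonOverlined (map proj₂ W) ≡ nonOverlined V
  stacked-nonOverlined empty = refl
  stacked-nonOverlined (single {v = v}) = refl
  stacked-nonOverlined (ascent {v = v} _ s) = nonOverlined-∷ v (stacked-nonOverlined s)
  stacked-nonOverlined (descent {v = v} {V = V} _ s) =
    nonOverlined-∷ v (trans (stacked-nonOverlined s) (nonOverlined-raise V))
  stacked-nonOverlined (merge {v = v} {V = V} _ s) =
    nonOverlined-∷ v (trans (stacked-nonOverlined s) (nonOverlined-raise-∷ʳ V))

  jump≡1 : ∀ {q} S′ {S} → All (Fin._< q) S → jump (q ∷ S′) S ≡ 1
  jump≡1 S′ S<q = cong (if_then 1 else 0) (dec-true (All.all? (Fin._<? _) _) S<q)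

  jump≡0 : ∀ {q} S′ {S} → ¬ All (Fin._< q) S → jump (q ∷ S′) S ≡ 0
  jump≡0 S′ S≮q = cong (if_then 1 else 0) (dec-false (All.all? (Fin._<? _) _) S≮q)

  jump-cases : ∀ q S′ S → (All (Fin._< q) S × jump (q ∷ S′) S ≡ 1) ⊎ (¬ All (Fin._< q) S × jump (q ∷ S′) S ≡ 0)
  jump-cases q S′ S = case All.all? (Fin._<? q) S of λ where
    (yes S<q) → inj₁ (S<q , jump≡1 S′ S<q)
    (no S≮q)  → inj₂ (S≮q , jump≡0 S′ S≮q)

  jump-merge : ∀ {p q} S′ S → p Fin.< q → jump S′ (p ∷ q ∷ S) ≡ jump S′ (q ∷ S)
  jump-merge [] S p<q = refl
  jump-merge {p} {q} (h ∷ S′) S p<q with All.all? (Fin._<? h) (q ∷ S)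
  ... | yes all@(q<h ∷ _) = trans (jump≡1 S′ (Fin.<-trans p<q q<h ∷ all)) (sym (jump≡1 S′ all))
  ... | no ¬all = trans (jump≡0 S′ (¬all ∘ All.tail)) (sym (jump≡0 S′ ¬all))

  -- The new index `p` lies below `q`, so no jump changes; the last block only gets longer by one,
  -- which adds 1 to the cⱼ of each other block.
  cost-merge : ∀ {p q} S B → p Fin.< q → cost ((p ∷ q ∷ S) ∷ B) ≡ length B + cost ((q ∷ S) ∷ B)
  cost-merge S [] p<q = refl
  cost-merge S (S′ ∷ B) p<q rewrite jump-merge S′ S p<q =
    solve 4 (λ l j s c → l :* (j :+ (con 1 :+ s)) :+ c := l :+ (l :* (j :+ s) :+ c)) refl
      (length (S′ ∷ B)) (jump S′ (_ ∷ S)) (length S) (cost (S′ ∷ B))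
    where open +-*-Solver

  -- Whatever a decrease takes from the values goes into the cost. In a `descent` every earlier
  -- value loses 1 and a jump of 1 is charged to every earlier block. In a `merge` the dropped value
  -- is 0, and lengthening the last block accounts for the other values.
  stacked-total : ∀ {W B V} → Stacked W B V → total-size (map proj₂ W) ≡ total-size V + cost B
  stacked-total empty = refl
  stacked-total single = sym (ℕ.+-identityʳ _)
  stacked-total (ascent {p} {v = v} {S = S} {B} {V} p≮q s)
    rewrite jump≡0 S {[ p ]} (p≮q ∘ All.head) | ℕ.*-zeroʳ (length B) | stacked-total s = sym (ℕ.+-assoc (size v) _ _)
  stacked-total (descent {v = v} {S = S} {B} {V} p<q s)
    rewrite jump≡1 S (p<q ∷ []) | ℕ.*-identityʳ (length B)
          | stacked-total s | total-size-raise V | sym (length-map raise V) | stacked-length s =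
    solve 4 (λ v l t c → v :+ ((l :+ t) :+ c) := (v :+ t) :+ (l :+ c)) refl
      (size v) (suc (length B)) (total-size V) (cost ((_ ∷ S) ∷ B))
    where open +-*-Solver
  stacked-total (merge {v = v} {S = S} {B} {V} p<q s)
    rewrite cost-merge S B p<q
          | stacked-total s | total-size-raise-∷ʳ V
          | ℕ.suc-injective (trans (sym (length-∷ʳ-raise V)) (stacked-length s)) =
    solve 4 (λ v l t c → v :+ ((l :+ t) :+ c) := (v :+ t) :+ (l :+ c)) refl
      (size v) (length B) (total-size V) (cost ((_ ∷ S) ∷ B))
    where open +-*-Solver

-- Words and stacks as lists of parts

module _ (N : ℕ) {x y u v : ℕ} where

  -- This lemma and the next three compare numbers N x + u lexicographically. The remainders range
  -- over {1,...,N}, in accordance with `β`, and not over {0,...,N-1}.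
  quotient-≤ : 1 ℕ.≤ u → v ℕ.≤ N → N * x + u ℕ.≤ N * y + v → x ℕ.≤ y
  quotient-≤ 1≤u v≤N le = ℕ.≮⇒≥ λ y<x → ℕ.<⇒≱ (begin-strict
    N * y + v   ≤⟨ ℕ.+-monoʳ-≤ (N * y) v≤N ⟩
    N * y + N   ≡⟨ trans (ℕ.+-comm (N * y) N) (sym (ℕ.*-suc N y)) ⟩
    N * suc y   ≤⟨ ℕ.*-monoʳ-≤ N y<x ⟩
    N * x       <⟨ ℕ.m<m+n (N * x) 1≤u ⟩
    N * x + u   ∎) le
    where open ℕ.≤-Reasoning

  quotient-< : v ℕ.< u → N * x + u ℕ.≤ N * y + v → x ℕ.< y
  quotient-< v<u le = ℕ.≰⇒> λ y≤x → ℕ.<⇒≱ (ℕ.+-mono-≤-< (ℕ.*-monoʳ-≤ N y≤x) v<u) le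

  multiple-≤ : x ℕ.≤ y → u ℕ.≤ v → N * x + u ℕ.≤ N * y + v
  multiple-≤ x≤y u≤v = ℕ.+-mono-≤ (ℕ.*-monoʳ-≤ N x≤y) u≤v

  multiple-< : x ℕ.< y → u ℕ.≤ N → 1 ℕ.≤ v → N * x + u ℕ.< N * y + v
  multiple-< x<y u≤N 1≤v = begin-strict
    N * x + u   ≤⟨ ℕ.+-monoʳ-≤ (N * x) u≤N ⟩
    N * x + N   ≡⟨ trans (ℕ.+-comm (N * x) N) (sym (ℕ.*-suc N x)) ⟩
    N * suc x   ≤⟨ ℕ.*-monoʳ-≤ N x<y ⟩
    N * y       <⟨ ℕ.m<m+n (N * y) 1≤v ⟩
    N * y + v   ∎
    where open ℕ.≤-Reasoning

module Words {r : ℕ} (N : ℕ) (ρ : Fin r → ℕ)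
  (1≤ρ : ∀ p → 1 ℕ.≤ ρ p) (ρ≤N : ∀ p → ρ p ℕ.≤ N)
  (ρ-anti : ∀ {p q} → p Fin.< q → ρ q ℕ.< ρ p)
  (n k : ℕ) where

  residues : List (Fin r) → ℕ
  residues = sum ∘ map ρ

  ⟦_⟧ : Letter → Part
  ⟦ p , part t o ⟧ = part (N * t + ρ p) o

  private
    ρ-anti-≤ : ∀ {p q} → ¬ p Fin.< q → ρ p ℕ.≤ ρ q
    ρ-anti-≤ {p} {q} p≮q with Fin.<-cmp p q
    ... | tri< p<q _ _  = contradiction p<q p≮q
    ... | tri≈ _ refl _ = ℕ.≤-refl
    ... | tri> _ _ q<p  = ℕ.<⇒≤ (ρ-anti q<p)

    ρ-injective : ∀ {p q} → ρ p ≡ ρ q → p ≡ q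
    ρ-injective {p} {q} eq with Fin.<-cmp p q
    ... | tri< p<q _ _  = contradiction (sym eq) (ℕ.<⇒≢ (ρ-anti p<q))
    ... | tri≈ _ p≡q _  = p≡q
    ... | tri> _ _ q<p  = contradiction eq (ℕ.<⇒≢ (ρ-anti q<p))

    ⟦⟧-injective : ∀ {x y} → ⟦ x ⟧ ≡ ⟦ y ⟧ → x ≡ y
    ⟦⟧-injective {p , part t o} {q , part t′ o′} eq with refl ← cong overlined eq
      with refl ← ℕ.≤-antisym (quotient-≤ N (1≤ρ p) (ρ≤N q) (ℕ.≤-reflexive (cong size eq)))
                              (quotient-≤ N (1≤ρ q) (ρ≤N p) (ℕ.≤-reflexive (cong size (sym eq))))
      with refl ← ρ-injective (ℕ.+-cancelˡ-≡ (N * t) _ _ (cong size eq)) = refl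

    ⟦⟧-◁ : ∀ x y → x ◁ y → ⟦ x ⟧ ⋖ ⟦ y ⟧
    ⟦⟧-◁ (p , part t o) (q , part t′ o′) (lt , ge) with p Fin.<? q
    ⟦⟧-◁ (p , part t false) (q , part t′ false) (lt , ge) | yes p<q =
      ℕ.<⇒≤ (multiple-< N (lt p<q) (ρ≤N p) (1≤ρ q))
    ⟦⟧-◁ (p , part t true) (q , part t′ true) (lt , ge) | yes p<q =
      ℕ.+-mono-≤-< (ℕ.*-monoʳ-≤ N (ℕ.s≤s⁻¹ (lt p<q))) (ρ-anti p<q)
    ⟦⟧-◁ (p , part t true) (q , part t′ false) (lt , ge) | yes p<q = lt p<q
    ⟦⟧-◁ (p , part t false) (q , part t′ true) (lt , ge) | yes p<q = tt
    ⟦⟧-◁ (p , part t false) (q , part t′ false) (lt , ge) | no p≮q =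
      multiple-≤ N (ge p≮q) (ρ-anti-≤ p≮q)
    ⟦⟧-◁ (p , part t true) (q , part t′ true) (lt , ge) | no p≮q =
      multiple-< N (ge p≮q) (ρ≤N q) (1≤ρ p)
    ⟦⟧-◁ (p , part t true) (q , part t′ false) (lt , ge) | no p≮q = ge p≮q
    ⟦⟧-◁ (p , part t false) (q , part t′ true) (lt , ge) | no p≮q = tt

    ⟦⟧-◁⁻ : ∀ x y → ⟦ x ⟧ ⋖ ⟦ y ⟧ → x ◁ y
    ⟦⟧-◁⁻ (p , part t false) (q , part t′ true) _ = (λ _ → tt) , (λ _ → tt)
    ⟦⟧-◁⁻ (p , part t false) (q , part t′ false) le =
      (λ p<q → quotient-< N (ρ-anti p<q) le) , (λ _ → quotient-≤ N (1≤ρ p) (ρ≤N q) le)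
    ⟦⟧-◁⁻ (p , part t true) (q , part t′ true) lt =
      (λ p<q → s≤s (quotient-≤ N (1≤ρ q) (ρ≤N p) (ℕ.<⇒≤ lt))) ,
      (λ p≮q → quotient-< N (s≤s (ρ-anti-≤ p≮q)) (subst (ℕ._≤ N * t + ρ p) (sym (ℕ.+-suc (N * t′) (ρ q))) lt))

  total-size-⟦⟧ : ∀ W → total-size (map ⟦_⟧ W) ≡ N * total-size (map proj₂ W) + residues (map proj₁ W)
  total-size-⟦⟧ [] = sym (trans (ℕ.+-identityʳ _) (ℕ.*-zeroʳ N))
  total-size-⟦⟧ ((p , part t _) ∷ W) rewrite total-size-⟦⟧ W =
    solve 5 (λ N t p T P → (N :* t :+ p) :+ (N :* T :+ P) := N :* (t :+ T) :+ (p :+ P)) refl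
      N t (ρ p) (total-size (map proj₂ W)) (residues (map proj₁ W))
    where open +-*-Solver

  nonOverlined-⟦⟧ : ∀ W → nonOverlined (map ⟦_⟧ W) ≡ nonOverlined (map proj₂ W)
  nonOverlined-⟦⟧ [] = refl
  nonOverlined-⟦⟧ ((_ , part _ false) ∷ W) = cong suc (nonOverlined-⟦⟧ W)
  nonOverlined-⟦⟧ ((_ , part _ true) ∷ W) = nonOverlined-⟦⟧ W

  -- From overpartitions through words and stacks to layouts.

  Colored : Part → Set
  Colored s = ∃[ x ] ⟦ x ⟧ ≡ s

  record IsColored (ps : List Part) : Set where
    constructor colored
    field
      parts  : All Colored ps
      linked : Linked _≻_ ps
      total  : total-size ps ≡ n
      plain  : nonOverlined ps ≡ k

  record IsWord (W : List Letter) : Set where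
    constructor word
    field
      linked : Linked _◁_ W
      total  : N * total-size (map proj₂ W) + residues (map proj₁ W) ≡ n
      plain  : nonOverlined (map proj₂ W) ≡ k

  record IsState (BV : List (List (Fin r)) × List Part) : Set where
    constructor mkState
    open Σ BV renaming (proj₁ to B; proj₂ to V)
    field
      valid : State B V
      total : N * (total-size V + cost B) + residues (concat B) ≡ n
      plain : nonOverlined V ≡ k

  -- Both sides are sorted arrangements of one multiset of parts, by `_≻_` and by `_⋖_`
  -- respectively.
  colored≃word : IsColored ≃ IsWord
  colored≃word = record
    { _~_ = λ ps W → ps ↭ map ⟦_⟧ W
    ; total = total′
    ; surjective = surjective′
    ; functional = λ (word l _ _) (word l′ _ _) π π′ → map-injective ⟦⟧-injective
        (PartOrder.sorted-unique ⋖-partOrder (linked-⟦⟧ l) (linked-⟦⟧ l′) (↭-trans (↭-sym π) π′))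
    ; injective = λ (colored _ l _ _) (colored _ l′ _ _) π π′ →
        PartOrder.sorted-unique ≻-partOrder l l′ (↭-trans π (↭-sym π′))
    }
    where
    linked-⟦⟧ : ∀ {W} → Linked _◁_ W → Linked _⋖_ (map ⟦_⟧ W)
    linked-⟦⟧ = Linked.map⁺ ∘ Linked.map (⟦⟧-◁ _ _)
    decode : ∀ {ps} → All Colored ps → ∃[ W ] map ⟦_⟧ W ≡ ps
    decode [] = [] , refl
    decode ((x , refl) ∷ c) with W , refl ← decode c = x ∷ W , refl
    encoded : ∀ W → All Colored (map ⟦_⟧ W)
    encoded [] = []
    encoded (x ∷ W) = (x , refl) ∷ encoded W
    total′ : ∀ {ps} → IsColored ps → ∃[ W ] (IsWord W × ps ↭ map ⟦_⟧ W)
    total′ (colored c l t m)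
      with qs , π , l′ ← PartOrder.sort ⋖-partOrder (PartOrder.linked⇒onlyPlainRepeats ≻-partOrder l)
      with W , refl ← decode (Perm.All-resp-↭ π c) =
      W , word (Linked.map (⟦⟧-◁⁻ _ _) (Linked.map⁻ l′))
               (trans (sym (total-size-⟦⟧ W)) (trans (sym (total-size-↭ π)) t))
               (trans (sym (nonOverlined-⟦⟧ W)) (trans (sym (nonOverlined-↭ π)) m)) , π
    surjective′ : ∀ {W} → IsWord W → ∃[ ps ] (IsColored ps × ps ↭ map ⟦_⟧ W)
    surjective′ {W} (word l t m)
      with ps , π , l′ ← PartOrder.sort ≻-partOrder (PartOrder.linked⇒onlyPlainRepeats ⋖-partOrder (linked-⟦⟧ l)) =
      ps , colored (Perm.All-resp-↭ π (encoded W)) l′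
             (trans (sym (total-size-↭ π)) (trans (total-size-⟦⟧ W) t))
             (trans (sym (nonOverlined-↭ π)) (trans (nonOverlined-⟦⟧ W) m)) , ↭-sym π

  private
    stacked-weight : ∀ {W B V} → Stacked W B V →
      N * total-size (map proj₂ W) + residues (map proj₁ W) ≡ N * (total-size V + cost B) + residues (concat B)
    stacked-weight s = cong₂ (λ t c → N * t + residues c) (stacked-total s) (stacked-colors s)

  word≃state : IsWord ≃ IsState
  word≃state = record
    { _~_ = λ W (B , V) → Stacked W B V
    ; total = λ {W} (word l t m) →
        let B , V , st , s = stack W l in
        (B , V) , mkState st (trans (sym (stacked-weight s)) t) (trans (sym (stacked-nonOverlined s)) m) , s
    ; surjective = surjective′
    ; functional = λ _ _ s s′ → let B≡ , V≡ = stacked-functional s s′ in cong₂ _,_ B≡ V≡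
    ; injective = λ _ _ → stacked-injective
    }
    where
    witness : ∀ {B V} → State B V → ∃[ W ] (Linked _◁_ W × Stacked W B V)
    witness {[]} {[]} _ = [] , [] , empty
    witness {S ∷ B} st = unstack S B _ st
    surjective′ : ∀ {BV} → IsState BV → ∃[ W ] (IsWord W × Stacked W (proj₁ BV) (proj₂ BV))
    surjective′ (mkState st t m) with W , l , s ← witness st =
      W , word l (trans (stacked-weight s) t) (trans (stacked-nonOverlined s) m) , s

  -- The numbers cⱼ above; here, unlike in Stacked, the first block comes first.
  offset : List (List (Fin r)) → ℕ
  offset []           = 0
  offset (S ∷ [])     = 0
  offset (S ∷ S′ ∷ B) = jump S S′ + pred (length S′) + offset (S′ ∷ B)

  offsets : List (List (Fin r)) → ℕ
  offsets []      = 0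
  offsets (S ∷ B) = offset (S ∷ B) + offsets B

  offset-∷ʳ : ∀ B S S′ → offset (B ++ S ∷ S′ ∷ []) ≡ offset (B ++ S ∷ []) + (jump S S′ + pred (length S′))
  offset-∷ʳ [] S S′ = ℕ.+-identityʳ _
  offset-∷ʳ (T ∷ []) S S′ =
    solve 2 (λ a b → a :+ (b :+ con 0) := (a :+ con 0) :+ b) refl
      (jump T S + pred (length S)) (jump S S′ + pred (length S′))
    where open +-*-Solver
  offset-∷ʳ (T ∷ T′ ∷ B) S S′ rewrite offset-∷ʳ (T′ ∷ B) S S′ =
    sym (ℕ.+-assoc (jump T T′ + pred (length T′)) _ _)

  offsets-∷ʳ : ∀ B S S′ →
    offsets (B ++ S ∷ S′ ∷ []) ≡ suc (length B) * (jump S S′ + pred (length S′)) + offsets (B ++ S ∷ [])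
  offsets-∷ʳ [] S S′ = refl
  offsets-∷ʳ (T ∷ B) S S′ rewrite offset-∷ʳ (T ∷ B) S S′ | offsets-∷ʳ B S S′ =
    solve 4 (λ a b c l → (a :+ b) :+ ((b :+ l :* b) :+ c) := (b :+ (b :+ l :* b)) :+ (a :+ c)) refl
      (offset (T ∷ B ++ S ∷ [])) (jump S S′ + pred (length S′)) (offsets (B ++ S ∷ [])) (length B)
    where open +-*-Solver

  -- Appending a block raises the offsets of all blocks before it by the same amount, which is the
  -- recursion defining `cost`.
  offsets-reverse : ∀ B → offsets (reverse B) ≡ cost B
  offsets-reverse [] = refl
  offsets-reverse (S ∷ []) = refl
  offsets-reverse (S ∷ S′ ∷ B) = begin
    offsets (reverse (S ∷ S′ ∷ B))
      ≡⟨ cong offsets (trans (unfold-reverse S (S′ ∷ B)) (cong (_++ [ S ]) (unfold-reverse S′ B))) ⟩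
    offsets ((reverse B ++ [ S′ ]) ++ [ S ])
      ≡⟨ cong offsets (++-assoc (reverse B) [ S′ ] [ S ]) ⟩
    offsets (reverse B ++ S′ ∷ S ∷ [])
      ≡⟨ offsets-∷ʳ (reverse B) S′ S ⟩
    suc (length (reverse B)) * j + offsets (reverse B ++ [ S′ ])
      ≡⟨ cong₂ (λ l c → suc l * j + c) (length-reverse B)
           (trans (cong offsets (sym (unfold-reverse S′ B))) (offsets-reverse (S′ ∷ B))) ⟩
    suc (length B) * j + cost (S′ ∷ B) ∎
    where
    open ≡-Reasoning
    j = jump S′ S + pred (length S)

  residues-concat : ∀ B → residues (concat B) ≡ sum (map residues B)
  residues-concat [] = refl
  residues-concat (S ∷ B) = trans (cong sum (map-++ ρ S (concat B)))
    (trans (sum-++ (map ρ S) _) (cong (λ z → residues S + z) (residues-concat B)))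

  -- The parts N xⱼ + ρ(Sⱼ) with xⱼ = vⱼ + cⱼ. If there are as many values as blocks, the last
  -- clause is reached only with both lists empty.
  build : List (List (Fin r)) → List Part → List Part
  build (S ∷ B) (part v o ∷ V) = part (N * (v + offset (S ∷ B)) + residues S) o ∷ build B V
  build _       _              = []

  total-size-build : ∀ B V → length V ≡ length B →
    total-size (build B V) ≡ N * (total-size V + offsets B) + sum (map residues B)
  total-size-build [] [] _ = sym (trans (ℕ.+-identityʳ _) (ℕ.*-zeroʳ N))
  total-size-build (S ∷ B) (part v o ∷ V) len rewrite total-size-build B V (ℕ.suc-injective len) =
    solve 7 (λ N v f s T F R → (N :* (v :+ f) :+ s) :+ (N :* (T :+ F) :+ R)
                            := N :* ((v :+ T) :+ (f :+ F)) :+ (s :+ R)) refl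
      N v (offset (S ∷ B)) (residues S) (total-size V) (offsets B) (sum (map residues B))
    where open +-*-Solver

  nonOverlined-build : ∀ B V → length V ≡ length B → nonOverlined (build B V) ≡ nonOverlined V
  nonOverlined-build [] [] _ = refl
  nonOverlined-build (S ∷ B) (part _ false ∷ V) len = cong suc (nonOverlined-build B V (ℕ.suc-injective len))
  nonOverlined-build (S ∷ B) (part _ true ∷ V) len = nonOverlined-build B V (ℕ.suc-injective len)

  record IsLayout (BV : List (List (Fin r)) × List Part) : Set where
    constructor layout
    open Σ BV renaming (proj₁ to B; proj₂ to V)
    field
      blocks : All Block B
      len    : length V ≡ length B
      linked : Linked _≻_ V
      total  : total-size (build B V) ≡ n
      plain  : nonOverlined V ≡ k

  -- The values are not tied to the blocks on which they were stacked: after sorting by `_≻_` they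
  -- are dealt out afresh to the reversed blocks. The total size depends only on the sum of the
  -- values and on the blocks.
  state≃layout : IsState ≃ IsLayout
  state≃layout = record
    { _~_ = λ (B , V) (B′ , V′) → reverse B ≡ B′ × V ↭ V′
    ; total = total′
    ; surjective = surjective′
    ; functional = λ where
        (layout _ _ l _ _) (layout _ _ l′ _ _) (refl , π) (refl , π′) →
          cong (_ ,_) (PartOrder.sorted-unique ≻-partOrder l l′ (↭-trans (↭-sym π) π′))
    ; injective = λ (mkState (state _ _ l) _ _) (mkState (state _ _ l′) _ _) (eq , π) (eq′ , π′) →
          cong₂ _,_ (reverse-injective (trans eq (sym eq′)))
                    (PartOrder.sorted-unique ⋖-partOrder l l′ (↭-trans π (↭-sym π′)))
    }
    where
    weight : ∀ B {V V′} → length V ≡ length B → V ↭ V′ →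
             total-size (build (reverse B) V′) ≡ N * (total-size V + cost B) + residues (concat B)
    weight B {V} {V′} len π = begin
      total-size (build (reverse B) V′)
        ≡⟨ total-size-build (reverse B) V′ (trans (sym (Perm.↭-length π)) (trans len (sym (length-reverse B)))) ⟩
      N * (total-size V′ + offsets (reverse B)) + sum (map residues (reverse B))
        ≡⟨ cong₂ (λ t c → N * (t + c) + sum (map residues (reverse B)))
             (total-size-↭ (↭-sym π)) (offsets-reverse B) ⟩
      N * (total-size V + cost B) + sum (map residues (reverse B))
        ≡⟨ cong (λ z → N * (total-size V + cost B) + z)
             (trans (sum-↭ (Perm.map⁺ residues (Perm.↭-reverse B))) (sym (residues-concat B))) ⟩
      N * (total-size V + cost B) + residues (concat B) ∎
      where open ≡-Reasoning
    total′ : ∀ {BV} → IsState BV → ∃[ BV′ ] (IsLayout BV′ × reverse (proj₁ BV) ≡ proj₁ BV′ × proj₂ BV ↭ proj₂ BV′)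
    total′ {B , V} (mkState (state bs len l) t m)
      with V′ , π , l′ ← PartOrder.sort ≻-partOrder (PartOrder.linked⇒onlyPlainRepeats ⋖-partOrder l) =
      (reverse B , V′) ,
      layout (Perm.All-resp-↭ (↭-sym (Perm.↭-reverse B)) bs)
             (trans (sym (Perm.↭-length π)) (trans len (sym (length-reverse B)))) l′
             (trans (weight B len π) t) (trans (sym (nonOverlined-↭ π)) m) ,
      refl , π
    surjective′ : ∀ {BV′} → IsLayout BV′ → ∃[ BV ] (IsState BV × reverse (proj₁ BV) ≡ proj₁ BV′ × proj₂ BV ↭ proj₂ BV′)
    surjective′ {B′ , V′} (layout bs len l t m)
      with V , π , l′ ← PartOrder.sort ⋖-partOrder (PartOrder.linked⇒onlyPlainRepeats ≻-partOrder l) =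
      (reverse B′ , V) ,
      mkState (state (Perm.All-resp-↭ (↭-sym (Perm.↭-reverse B′)) bs) lenV l′)
              (trans (sym (weight (reverse B′) lenV (↭-sym π)))
                (trans (cong (λ B → total-size (build B V′)) (reverse-involutive B′)) t))
              (trans (sym (nonOverlined-↭ π)) m) ,
      reverse-involutive B′ , ↭-sym π
      where
      lenV : length V ≡ length (reverse B′)
      lenV = trans (sym (Perm.↭-length π)) (trans len (sym (length-reverse B′)))

  Number-colored⇒layout : ∀ {m} → Number IsColored m → Number IsLayout m
  Number-colored⇒layout = Number-≃ state≃layout ∘ Number-≃ word≃state ∘ Number-≃ colored≃word

-- Subsets of Fin r as increasing lists

Increasing : ∀ {r} → List (Fin r) → Set
Increasing = AllPairs Fin._<_

elements : ∀ {r} → Subset r → List (Fin r)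
elements []            = []
elements (inside ∷ S)  = Fin.zero ∷ map Fin.suc (elements S)
elements (outside ∷ S) = map Fin.suc (elements S)

increasing-suc : ∀ {r} {L : List (Fin r)} → Increasing L → Increasing (map Fin.suc L)
increasing-suc = AllPairs.map⁺ ∘ AllPairs.map s≤s

0<suc : ∀ {r} (L : List (Fin r)) → All (Fin._<_ {suc r} Fin.zero) (map Fin.suc L)
0<suc L = All.map⁺ (All.universal (λ _ → s≤s z≤n) L)

elements-increasing : ∀ {r} (S : Subset r) → Increasing (elements S)
elements-increasing []            = []
elements-increasing (inside ∷ S)  = 0<suc (elements S) ∷ increasing-suc (elements-increasing S)
elements-increasing (outside ∷ S) = increasing-suc (elements-increasing S)

length-elements : ∀ {r} (S : Subset r) → length (elements S) ≡ ∣ S ∣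
length-elements []            = refl
length-elements (inside ∷ S)  = cong suc (trans (length-map Fin.suc (elements S)) (length-elements S))
length-elements (outside ∷ S) = trans (length-map Fin.suc (elements S)) (length-elements S)

∈-elements⁺ : ∀ {r i} {S : Subset r} → i ∈ₛ S → i ∈ elements S
∈-elements⁺ {S = inside ∷ S}  here       = here refl
∈-elements⁺ {S = inside ∷ S}  (there i∈) = there (∈-map⁺ Fin.suc (∈-elements⁺ i∈))
∈-elements⁺ {S = outside ∷ S} (there i∈) = ∈-map⁺ Fin.suc (∈-elements⁺ i∈)

All-∈-elements : ∀ {r} (S : Subset r) → All (_∈ₛ S) (elements S)
All-∈-elements []            = []
All-∈-elements (inside ∷ S)  = here ∷ All.map⁺ (All.map there (All-∈-elements S))
All-∈-elements (outside ∷ S) = All.map⁺ (All.map there (All-∈-elements S))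

-- Splits an increasing list by whether 0 is listed, in parallel to `inside` and `outside` for a
-- subset.
data IncreasingView {r} : List (Fin (suc r)) → Set where
  without-0 : ∀ {L} → Increasing L → IncreasingView (map Fin.suc L)
  with-0    : ∀ {L} → Increasing L → IncreasingView (Fin.zero ∷ map Fin.suc L)

increasingView : ∀ {r} {L : List (Fin (suc r))} → Increasing L → IncreasingView L
increasingView [] = without-0 []
increasingView {L = Fin.zero ∷ L} (0< ∷ inc) with increasingView inc
... | without-0 inc′ = with-0 inc′
... | with-0 _       with () ∷ _ ← 0<
increasingView {L = Fin.suc i ∷ L} (i< ∷ inc) with increasingView inc
... | without-0 inc′ = without-0 (All.map ℕ.s≤s⁻¹ (All.map⁻ i<) ∷ inc′)
... | with-0 _       with () ∷ _ ← i<

elements-surjective : ∀ {r} (L : List (Fin r)) → Increasing L → ∃[ S ] elements S ≡ L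
elements-surjective {zero} [] _ = [] , refl
elements-surjective {suc r} L inc with increasingView inc
... | without-0 inc′ = let S , eq = elements-surjective _ inc′ in outside ∷ S , cong (map Fin.suc) eq
... | with-0 inc′ = let S , eq = elements-surjective _ inc′ in inside ∷ S , cong ((Fin.zero ∷_) ∘ map Fin.suc) eq

subsetSum-elements : ∀ {r} (b : Fin r → ℕ) (a : Fin r → ℤ) → (∀ i → a i ≡ + b i) →
  ∀ S → subsetSum a S ≡ + sum (map b (elements S))
subsetSum-elements b a a≡b [] = refl
subsetSum-elements b a a≡b (inside ∷ S) =
  cong₂ ℤ._+_ (a≡b Fin.zero) (trans (subsetSum-elements (b ∘ Fin.suc) (a ∘ Fin.suc) (a≡b ∘ Fin.suc) S)
    (cong (+_ ∘ sum) (map-∘ (elements S))))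
subsetSum-elements b a a≡b (outside ∷ S) = trans (ℤ.+-identityˡ _)
  (trans (subsetSum-elements (b ∘ Fin.suc) (a ∘ Fin.suc) (a≡b ∘ Fin.suc) S) (cong (+_ ∘ sum) (map-∘ (elements S))))

-- The terms left out are nonnegative. The generality in `a` and `b` lets this serve both for the
-- full sum, bounded by N, and for the sum over the indices below some k.
increasing-sum≤∑ : ∀ {r} (b : Fin r → ℕ) (a : Fin r → ℤ) → (∀ i → a i ≡ + b i) →
  ∀ {L} → Increasing L → + sum (map b L) ℤ.≤ ∑[ i < r ] a i
increasing-sum≤∑ {zero} b a a≡b {[]} _ = ℤ.≤-refl
increasing-sum≤∑ {suc r} b a a≡b inc with increasingView inc
... | with-0 {L} inc′ = ℤ.+-mono-≤ (ℤ.≤-reflexive (sym (a≡b Fin.zero)))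
        (subst (λ s → + sum s ℤ.≤ ∑[ i < r ] a (Fin.suc i)) (map-∘ L)
          (increasing-sum≤∑ (b ∘ Fin.suc) (a ∘ Fin.suc) (a≡b ∘ Fin.suc) inc′))
... | without-0 {L} inc′ = ℤ.≤-trans
        (subst (λ s → + sum s ℤ.≤ ∑[ i < r ] a (Fin.suc i)) (map-∘ L)
          (increasing-sum≤∑ (b ∘ Fin.suc) (a ∘ Fin.suc) (a≡b ∘ Fin.suc) inc′))
        (subst (λ c → ∑[ i < r ] a (Fin.suc i) ℤ.≤ c ℤ.+ ∑[ i < r ] a (Fin.suc i)) (sym (a≡b Fin.zero))
          (ℤ.i≤j+i _ (+ b Fin.zero)))

0≤∑ : ∀ {r} {a : Fin r → ℤ} → (∀ i → 0ℤ ℤ.≤ a i) → 0ℤ ℤ.≤ ∑[ i < r ] a i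
0≤∑ {zero}  _   = ℤ.≤-refl
0≤∑ {suc r} 0≤a = ℤ.+-mono-≤ (0≤a Fin.zero) (0≤∑ (0≤a ∘ Fin.suc))

inject-surjective : ∀ {r} {i k : Fin r} → i Fin.< k → ∃[ j ] inject {i = k} j ≡ i
inject-surjective i<k = Fin.fromℕ< i<k , Fin.toℕ-injective (trans (Fin.toℕ-inject _) (Fin.toℕ-fromℕ< i<k))

increasing-inject⁻ : ∀ {r} {k : Fin r} {L} → Increasing L → All (Fin._< k) L →
  ∃[ L′ ] (Increasing L′ × map (inject {i = k}) L′ ≡ L)
increasing-inject⁻ [] [] = [] , [] , refl
increasing-inject⁻ {k = k} {i ∷ L} (i< ∷ inc) (i<k ∷ L<k)
  with j , refl ← inject-surjective {k = k} i<k
  with L′ , inc′ , refl ← increasing-inject⁻ inc L<k =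
  j ∷ L′ , All.map (λ lt → subst₂ ℕ._<_ (Fin.toℕ-inject j) (Fin.toℕ-inject _) lt) (All.map⁻ i<) ∷ inc′ , refl

-- Least positive residues.

module _ {N l c : ℕ} where

  mod⇔∣ : (+ l ≡ ℤ.- (+ c) [mod N ]) ⇔ N ∣ l + c
  mod⇔∣ rewrite ℤ.neg-involutive (+ c) = mk⇔ (λ d → d) (λ d → d)

private
  -- The integer k must be 0 or positive: a negative k would force t ≥ N. A positive k gives c ≥ t +
  -- N, which leaves only c = N and t = 0.
  positive-residue : ∀ {N c t} k → 1 ℕ.≤ c → c ℕ.≤ N → t ℕ.< N → + c ≡ + t ℤ.+ k ℤ.* + N →
                     (t ≡ 0 × c ≡ N) ⊎ (c ≡ t × t ≢ 0)
  positive-residue {N} {c} {t} (+ zero) 1≤c c≤N t<N eq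
    with refl ← ℤ.+-injective (trans eq (ℤ.+-identityʳ (+ t))) = inj₂ (refl , λ where refl → ℕ.<⇒≢ 1≤c refl)
  positive-residue {N} {c} {t} (+ suc k) 1≤c c≤N t<N eq = inj₁ (t≡0 , c≡N)
    where
    c≡ : c ≡ t + (N + k * N)
    c≡ = ℤ.+-injective (trans eq (cong (ℤ._+_ (+ t)) (sym (ℤ.pos-* (suc k) N))))
    t+N≤N : t + N ℕ.≤ N
    t+N≤N = ℕ.≤-trans (ℕ.+-monoʳ-≤ t (ℕ.m≤m+n N (k * N))) (subst (ℕ._≤ N) c≡ c≤N)
    t≡0 : t ≡ 0
    t≡0 = ℕ.n≤0⇒n≡0 (ℕ.+-cancelʳ-≤ N t 0 t+N≤N)
    c≡N : c ≡ N
    c≡N = ℕ.≤-antisym c≤N (subst (N ℕ.≤_) (sym c≡) (ℕ.≤-trans (ℕ.m≤m+n N (k * N)) (ℕ.m≤n+m _ t)))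
  positive-residue {N} {c} {t} -[1+ k ] 1≤c c≤N t<N eq = contradiction t<N (ℕ.≤⇒≯ N≤t)
    where
    open ℤ-Solver
    c+kN≡t : + c ℤ.+ + (suc k) ℤ.* + N ≡ + t
    c+kN≡t = trans (cong (ℤ._+ + (suc k) ℤ.* + N) eq)
      (solve 3 (λ t k N → (t :+ (:- k) :* N) :+ k :* N := t) refl (+ t) (+ suc k) (+ N))
    N≤t : N ℕ.≤ t
    N≤t = subst (N ℕ.≤_) (ℤ.+-injective (trans (cong (ℤ._+_ (+ c)) (ℤ.pos-* (suc k) N)) c+kN≡t))
      (ℕ.≤-trans (ℕ.m≤m+n N (k * N)) (ℕ.m≤n+m _ c))

  residue-quotient : ∀ {N l c t} m q → l + c ≡ m * N → ℤ.- (+ l) ≡ + t ℤ.+ q ℤ.* + N →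
                     + c ≡ + t ℤ.+ (+ m ℤ.+ q) ℤ.* + N
  residue-quotient {N} {l} {c} {t} m q l+c≡mN -l≡t+qN = begin
    + c                                  ≡⟨ solve 2 (λ l c → c := (l :+ c) :+ (:- l)) refl (+ l) (+ c) ⟩
    + (l + c) ℤ.+ ℤ.- (+ l)              ≡⟨ cong₂ ℤ._+_ (trans (cong +_ l+c≡mN) (ℤ.pos-* m N)) -l≡t+qN ⟩
    + m ℤ.* + N ℤ.+ (+ t ℤ.+ q ℤ.* + N)  ≡⟨ solve 4 (λ m N t q → m :* N :+ (t :+ q :* N) := t :+ (m :+ q) :* N) refl (+ m) (+ N) (+ t) q ⟩
    + t ℤ.+ (+ m ℤ.+ q) ℤ.* + N          ∎
    where open ≡-Reasoning
          open ℤ-Solver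

-- From l + c = m N and -l = t + q N follows c = t + (m + q) N. The remainder t = 0 is the case in
-- which `β` returns N, and there c = N.
β-neg : ∀ {N l c} .{{_ : NonZero N}} → 1 ℕ.≤ c → c ℕ.≤ N → N ∣ l + c → β N (ℤ.- (+ l)) ≡ + c
β-neg {N} {l} {c} 1≤c c≤N (divides m l+c≡mN)
  with ℤ.- (+ l) %ℕ N | n%ℕd<d (ℤ.- (+ l)) N | ℤ.- (+ l) /ℕ N | a≡a%ℕn+[a/ℕn]*n (ℤ.- (+ l)) N
... | t | t<N | q | -l≡t+qN
    with positive-residue (+ m ℤ.+ q) 1≤c c≤N t<N (residue-quotient m q l+c≡mN -l≡t+qN)
...   | inj₁ (refl , refl) = refl
...   | inj₂ (refl , t≢0) with t
...     | zero  = contradiction refl t≢0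
...     | suc _ = refl

-- The integers a(i)

module Colours {r : ℕ} (a : Fin r → ℤ)
  (superincreasing : ∀ (k : Fin r) → ∑[ i < toℕ k ] a (inject {i = k} i) ℤ.< a k)
  (distinctSums : ∀ (S S′ : Subset r) → Nonempty S → Nonempty S′ →
    subsetSum a S ≡ subsetSum a S′ → S ≡ S′)
  (N : ℕ) .{{_ : NonZero N}} (∑a≤N : ∑[ i < r ] a i ℤ.≤ + N) where

  private
    -- Strong induction: the terms before k are positive, so their sum is at least 0, and a(k) is
    -- greater than that sum.
    0<a : ∀ k → 0ℤ ℤ.< a k
    0<a k = go k (Fin.<-wellFounded k)
      where
      go : ∀ k → Acc Fin._<_ k → 0ℤ ℤ.< a k
      go k (acc smaller) = ℤ.≤-<-trans
        (0≤∑ λ i → ℤ.<⇒≤ (go (inject i) (smaller (subst (ℕ._< toℕ k) (sym (Fin.toℕ-inject i)) (Fin.toℕ<n i)))))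
        (superincreasing k)

  â : Fin r → ℕ
  â i = ℤ.∣ a i ∣

  Σâ : List (Fin r) → ℕ
  Σâ = sum ∘ map â

  a≡â : ∀ i → a i ≡ + â i
  a≡â i = sym (ℤ.0≤i⇒+∣i∣≡i (ℤ.<⇒≤ (0<a i)))

  1≤â : ∀ i → 1 ℕ.≤ â i
  1≤â i = ℤ.drop‿+<+ (subst (0ℤ ℤ.<_) (a≡â i) (0<a i))

  -- The hypothesis bounds the sum over all indices below k, and `L` omits only nonnegative terms of
  -- it.
  Σâ<â : ∀ {k L} → Increasing L → All (Fin._< k) L → Σâ L ℕ.< â k
  Σâ<â {k} inc L<k with L′ , inc′ , refl ← increasing-inject⁻ inc L<k =
    ℤ.drop‿+<+ (subst₂ ℤ._<_ (cong (+_ ∘ sum) (map-∘ L′)) (a≡â k)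
      (ℤ.≤-<-trans (increasing-sum≤∑ (â ∘ inject) (a ∘ inject) (a≡â ∘ inject) inc′) (superincreasing k)))

  Σâ≤N : ∀ {L} → Increasing L → Σâ L ℕ.≤ N
  Σâ≤N inc = ℤ.drop‿+≤+ (ℤ.≤-trans (increasing-sum≤∑ â a a≡â inc) ∑a≤N)

  â-mono : ∀ {p q} → p Fin.< q → â p ℕ.< â q
  â-mono {p} p<q = ℕ.≤-<-trans (ℕ.m≤m+n (â p) 0) (Σâ<â ([] ∷ []) (p<q ∷ []))

  â≤N : ∀ p → â p ℕ.≤ N
  â≤N p = ℕ.≤-trans (ℕ.m≤m+n (â p) 0) (Σâ≤N {[ p ]} ([] ∷ []))

  â≤Σâ : ∀ {p L} → p ∈ L → â p ℕ.≤ Σâ L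
  â≤Σâ (here refl) = ℕ.m≤m+n _ _
  â≤Σâ (there p∈)  = ℕ.≤-trans (â≤Σâ p∈) (ℕ.m≤n+m _ _)

  block-increasing : ∀ {S : List (Fin r)} → Block S → Increasing S
  block-increasing {_ ∷ _} b = b

  1≤Σâ : ∀ {S} → Block S → 1 ℕ.≤ Σâ S
  1≤Σâ {p ∷ _} _ = ℕ.≤-trans (1≤â p) (ℕ.m≤m+n (â p) _)

  block⇒subset : ∀ {S : List (Fin r)} → Block S → ∃[ S′ ] (Nonempty S′ × elements S′ ≡ S)
  block⇒subset {S} b with S′ , refl ← elements-surjective S (block-increasing b) =
    S′ , nonempty (elements S′) (All-∈-elements S′) b , refl
    where
    nonempty : ∀ L → All (_∈ₛ S′) L → Block L → Nonempty S′
    nonempty (p ∷ _) (p∈ ∷ _) _ = p , p∈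

  subset⇒block : ∀ (S : Subset r) → Nonempty S → Block (elements S)
  subset⇒block S (p , p∈) = block (elements S) (elements-increasing S) (∈-elements⁺ p∈)
    where
    block : ∀ L → Increasing L → p ∈ L → Block L
    block (_ ∷ _) inc _ = inc

  subsetSum≡Σâ : ∀ S → subsetSum a S ≡ + Σâ (elements S)
  subsetSum≡Σâ = subsetSum-elements â a a≡â

  Σâ-injective : ∀ {S T} → Block S → Block T → Σâ S ≡ Σâ T → S ≡ T
  Σâ-injective bS bT eq with S , neS , refl ← block⇒subset bS with T , neT , refl ← block⇒subset bT =
    cong elements (distinctSums S T neS neT
      (trans (subsetSum≡Σâ S) (trans (cong +_ eq) (sym (subsetSum≡Σâ T)))))

  -- Distinctness of the sums forces the subset found by `A′?` to be the given one.
  w-Σâ : ∀ {S} → Block S → w a (+ Σâ S) ≡ + length S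
  w-Σâ b with S , ne , refl ← block⇒subset b with A′? a (+ Σâ (elements S))
  ... | no ¬A′ = contradiction (S , ne , subsetSum≡Σâ S) ¬A′
  ... | yes (S′ , ne′ , eq) with refl ← distinctSums S′ S ne′ ne (trans eq (sym (subsetSum≡Σâ S))) =
    cong +_ (sym (length-elements S))

  -- The a(i) increase with i, so the smallest term belongs to the head of the block.
  v-Σâ : ∀ {p L} → Block (p ∷ L) → v a (+ Σâ (p ∷ L)) ≡ + â p
  v-Σâ {p} {L} b with S , ne , eqS ← block⇒subset b with A′? a (+ Σâ (p ∷ L))
  ... | no ¬A′ = contradiction (S , ne , trans (subsetSum≡Σâ S) (cong (+_ ∘ Σâ) eqS)) ¬A′
  ... | yes (S′ , ne′@(i₀ , i₀∈) , eq)
    with refl ← distinctSums S′ S ne′ ne (trans eq (trans (cong (+_ ∘ Σâ) (sym eqS)) (sym (subsetSum≡Σâ S)))) =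
    trans (min≈v⁺ (∈-map⁺ a (∈-filter⁺ (_∈? S) (∈-allFin p) p∈))
                  (All.map⁺ (All.map least (All.all-filter (_∈? S) (allFin r))))
                  (least i₀∈))
          (a≡â p)
    where
    p∈ : p ∈ₛ S
    p∈ = All.head (subst (All (_∈ₛ S)) eqS (All-∈-elements S))
    least : ∀ {i} → i ∈ₛ S → a p ℤ.≤ a i
    least {i} i∈ with subst (i ∈_) eqS (∈-elements⁺ i∈)
    ... | here refl = ℤ.≤-refl
    ... | there i∈L = subst₂ ℤ._≤_ (sym (a≡â p)) (sym (a≡â i))
                        (ℤ.+≤+ (ℕ.<⇒≤ (â-mono (All.lookup (AllPairs.head b) i∈L))))

  A′⇒block : ∀ {l} → -A′[_] a N l → ∃[ S ] (Block S × N ∣ l + Σâ S)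
  A′⇒block {l} (_ , _ , (S , ne , refl) , eq) =
    elements S , subset⇒block S ne ,
    Equivalence.to (mod⇔∣ {N} {l} {Σâ (elements S)}) (subst (λ c → + l ≡ ℤ.- c [mod N ]) (subsetSum≡Σâ S) eq)

  block⇒A′ : ∀ {l S} → 1 ℕ.≤ l → Block S → N ∣ l + Σâ S → -A′[_] a N l
  block⇒A′ {l} 1≤l b d with S , ne , refl ← block⇒subset b =
    1≤l , _ , (S , ne , refl) ,
    subst (λ c → + l ≡ ℤ.- c [mod N ]) (sym (subsetSum≡Σâ S)) (Equivalence.from (mod⇔∣ {N} {l} {Σâ (elements S)}) d)

  -- The representative of -a(i) in {1,…,N} is N - a(i), except that it is N when
  -- a(i) = N.  The exception forces r = 1, so N(1 + e) - a(i) covers both cases with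
  -- e independent of i.
  data Slack : ℕ → Set where
    none : (∀ p → â p ℕ.< N) → Slack 0
    full : (∀ p → â p ≡ N) → (∀ (p q : Fin r) → ¬ p Fin.< q) → Slack 1

  -- If some a(c) equals N, any second index would push the sum of all a(i) beyond N, so c is the
  -- only index.
  slack : ∃[ e ] Slack e
  slack with Fin.any? (λ p → â p ℕ.≟ N)
  ... | no ¬full = 0 , none (λ p → ℕ.≤∧≢⇒< (â≤N p) (λ eq → ¬full (p , eq)))
  ... | yes (c , âc≡N) = 1 , full (λ p → trans (cong â (only p)) âc≡N) (λ p q p<q →
          ℕ.<-irrefl refl (subst₂ Fin._<_ (only p) (only q) p<q))
    where
    not-both : ∀ {p q} → p Fin.< q → ¬ (â p ≡ N ⊎ â q ≡ N)
    not-both {p} {q} p<q either = ℕ.<⇒≱ (N< either) (Σâ≤N {p ∷ q ∷ []} ((p<q ∷ []) ∷ [] ∷ []))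
      where
      N< : â p ≡ N ⊎ â q ≡ N → N ℕ.< Σâ (p ∷ q ∷ [])
      N< (inj₁ refl) = ℕ.m<m+n (â p) (ℕ.≤-trans (1≤â q) (ℕ.m≤m+n (â q) 0))
      N< (inj₂ refl) = subst (ℕ._< Σâ (p ∷ q ∷ [])) (ℕ.+-identityʳ (â q)) (ℕ.m<n+m (â q + 0) (1≤â p))
    only : ∀ p → p ≡ c
    only p with Fin.<-cmp p c
    ... | tri< p<c _ _ = contradiction (inj₂ âc≡N) (not-both p<c)
    ... | tri≈ _ p≡c _ = p≡c
    ... | tri> _ _ c<p = contradiction (inj₁ âc≡N) (not-both c<p)

  e : ℕ
  e = proj₁ slack

  ρ : Fin r → ℕ
  ρ p = N * suc e ℕ.∸ â p

  ρ+â : ∀ p → ρ p + â p ≡ N * suc e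
  ρ+â p = ℕ.m∸n+n≡m (ℕ.≤-trans (â≤N p) (ℕ.m≤m*n N (suc e)))

  1≤ρ : ∀ p → 1 ℕ.≤ ρ p
  1≤ρ p = ℕ.m<n⇒0<n∸m (helper (proj₂ slack))
    where
    helper : ∀ {e} → Slack e → â p ℕ.< N * suc e
    helper (none â<N) = subst (â p ℕ.<_) (sym (ℕ.*-identityʳ N)) (â<N p)
    helper (full â≡N _) = subst (ℕ._< N * 2) (sym (â≡N p)) (ℕ.m<m*n N 2 ℕ.≤-refl)

  ρ≤N : ∀ p → ρ p ℕ.≤ N
  ρ≤N p = helper (proj₂ slack)
    where
    helper : ∀ {e} → Slack e → N * suc e ℕ.∸ â p ℕ.≤ N
    helper (none _) = ℕ.≤-trans (ℕ.m∸n≤m (N * 1) (â p)) (ℕ.≤-reflexive (ℕ.*-identityʳ N))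
    helper (full â≡N _) rewrite â≡N p | ℕ.*-suc N 1 | ℕ.*-identityʳ N | ℕ.m+n∸m≡n N N = ℕ.≤-refl

  ρ-anti : ∀ {p q} → p Fin.< q → ρ q ℕ.< ρ p
  ρ-anti {p} {q} p<q = ℕ.∸-monoʳ-< (â-mono p<q) (ℕ.≤-trans (â≤N q) (ℕ.m≤m*n N (suc e)))

  -- Summing ρ(p) + a(p) = N (1 + e) over S gives N (1 + e) |S|. This equals N (e + |S|), because
  -- either e = 0 or |S| = 1.
  residues+Σâ : ∀ {S} → Block S → sum (map ρ S) + Σâ S ≡ N * (e + length S)
  residues+Σâ {S} b = trans (total S) (cong (N *_) (helper S b (proj₂ slack)))
    where
    open +-*-Solver
    total : ∀ S → sum (map ρ S) + Σâ S ≡ N * (suc e * length S)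
    total [] = sym (trans (cong (N *_) (ℕ.*-zeroʳ (suc e))) (ℕ.*-zeroʳ N))
    total (p ∷ S) = trans
      (solve 4 (λ a b c d → (a :+ b) :+ (c :+ d) := (a :+ c) :+ (b :+ d)) refl (ρ p) (sum (map ρ S)) (â p) (Σâ S))
      (trans (cong₂ _+_ (ρ+â p) (total S))
        (solve 3 (λ N e l → N :* e :+ N :* (e :* l) := N :* (e :* (con 1 :+ l))) refl N (suc e) (length S)))
    helper : ∀ S {e} → Block S → Slack e → suc e * length S ≡ e + length S
    helper S b (none _) = ℕ.+-identityʳ (length S)
    helper (p ∷ []) b (full _ _) = refl
    helper (p ∷ q ∷ _) ((p<q ∷ _) ∷ _) (full _ ≮) = contradiction p<q (≮ p q)


  -- The gap condition as an inequality between natural numbers.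

  χℕ : Part → ℕ
  χℕ p = if overlined p then 1 else 0

  χ≡χℕ : ∀ p → χ p ≡ + χℕ p
  χ≡χℕ (part _ true)  = refl
  χ≡χℕ (part _ false) = refl

  ≻⇒χ : ∀ p q → p ≻ q → size q + χℕ q ℕ.≤ size p
  ≻⇒χ p (part t false) = subst (ℕ._≤ size p) (sym (ℕ.+-identityʳ t))
  ≻⇒χ p (part t true)  = subst (ℕ._≤ size p) (ℕ.+-comm 1 t)

  χ⇒≻ : ∀ p q → size q + χℕ q ℕ.≤ size p → p ≻ q
  χ⇒≻ p (part t false) = subst (ℕ._≤ size p) (ℕ.+-identityʳ t)
  χ⇒≻ p (part t true)  = subst (ℕ._≤ size p) (ℕ.+-comm t 1)

  -- With p the least index of a block, a(p) is its v. It exceeds the sum over T exactly when all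
  -- indices of T lie below p, so `jump` is the carry in passing to the quotients X and Y.
  jump-Σâ⁺ : ∀ {p L T X Y} → Block T → N * X + â p ℕ.≤ N * Y + Σâ T → X + jump (p ∷ L) T ℕ.≤ Y
  jump-Σâ⁺ {p} {L} {T} {X} {Y} bT le with jump-cases p L T
  ... | inj₁ (T<p , j≡1) = subst (λ j → X + j ℕ.≤ Y) (sym j≡1)
                    (subst (ℕ._≤ Y) (ℕ.+-comm 1 X) (quotient-< N (Σâ<â (block-increasing bT) T<p) le))
  ... | inj₂ (T≮p , j≡0) = subst (λ j → X + j ℕ.≤ Y) (sym j≡0)
                    (subst (ℕ._≤ Y) (sym (ℕ.+-identityʳ X)) (quotient-≤ N (1≤â p) (Σâ≤N (block-increasing bT)) le))

  jump-Σâ⁻ : ∀ {p L T X Y} → Block T → X + jump (p ∷ L) T ℕ.≤ Y → N * X + â p ℕ.≤ N * Y + Σâ T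
  jump-Σâ⁻ {p} {L} {T} {X} {Y} bT le with jump-cases p L T
  ... | inj₁ (T<p , j≡1) = ℕ.<⇒≤ (multiple-< N (subst (ℕ._≤ Y) (ℕ.+-comm X 1) (subst (λ j → X + j ℕ.≤ Y) j≡1 le))
                    (â≤N p) (1≤Σâ bT))
  ... | inj₂ (T≮p , j≡0) = multiple-≤ N (subst (ℕ._≤ Y) (ℕ.+-identityʳ X) (subst (λ j → X + j ℕ.≤ Y) j≡0 le)) âp≤
    where
    -- Some index q of `T` is at least p, and a(p) ≤ a(q) is bounded by the sum over `T`.
    âp≤ : â p ℕ.≤ Σâ T
    âp≤ with q , q∈ , q≮p ← find (All.¬All⇒Any¬ (Fin._<? p) T T≮p) with Fin.<-cmp p q
    ... | tri< p<q _ _  = ℕ.≤-trans (ℕ.<⇒≤ (â-mono p<q)) (â≤Σâ q∈)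
    ... | tri≈ _ refl _ = â≤Σâ q∈
    ... | tri> _ _ q<p  = contradiction q<p q≮p

  module _ {p : Fin r} {L : List (Fin r)} (b : Block (p ∷ L)) (s : Part) (d : N ∣ size s + Σâ (p ∷ L)) where
    private
      α = Σâ (p ∷ L)
      l = length (p ∷ L)
      β≡α : β N (ℤ.- (+ size s)) ≡ + α
      β≡α = β-neg {l = size s} (1≤Σâ b) (Σâ≤N b) d

    gap⇔ : ∀ t → Gap a N s t ⇔ (N * (l + χℕ t) + â p + size t ℕ.≤ size s + α + N)
    gap⇔ t rewrite β≡α | w-Σâ b | v-Σâ b | χ≡χℕ t = mk⇔
      (λ le → ℤ.drop‿+≤+ (subst₂ ℤ._≤_ lhs rhs (ℤ.+-monoˡ-≤ c le)))
      (λ le → ℤ.≤-trans (ℤ.≤-reflexive (cancel _)) (ℤ.≤-trans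
         (ℤ.+-monoˡ-≤ (ℤ.- c) (subst₂ ℤ._≤_ (sym lhs) (sym rhs) (ℤ.+≤+ le))) (ℤ.≤-reflexive (sym (cancel _)))))
      where
      open ℤ-Solver
      -- Adding t + α + N to both sides clears every subtraction, including the one in w - 1.
      c = + size t ℤ.+ + α ℤ.+ + N
      cancel : ∀ x → x ≡ x ℤ.+ c ℤ.+ ℤ.- c
      cancel x = solve 2 (λ x c → x := x :+ c :+ (:- c)) refl x c
      lhs : (+ N ℤ.* (+ l ℤ.- 1ℤ ℤ.+ + χℕ t) ℤ.+ + â p ℤ.- + α) ℤ.+ c ≡ + (N * (l + χℕ t) + â p + size t)
      lhs = trans (solve 6 (λ N l x h α t → (N :* (l :- con 1ℤ :+ x) :+ h :- α) :+ (t :+ α :+ N)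
                                          := N :* (l :+ x) :+ h :+ t) refl
                    (+ N) (+ l) (+ χℕ t) (+ â p) (+ α) (+ size t))
              (cong (λ z → z ℤ.+ + â p ℤ.+ + size t) (sym (ℤ.pos-* N (l + χℕ t))))
      rhs : (+ size s ℤ.- + size t) ℤ.+ c ≡ + (size s + α + N)
      rhs = solve 4 (λ s t α N → (s :- t) :+ (t :+ α :+ N) := s :+ α :+ N) refl (+ size s) (+ size t) (+ α) (+ N)

    lastBound⇔ : LastBound a N s ⇔ (N * l ℕ.≤ size s + N)
    lastBound⇔ rewrite β≡α | w-Σâ b = mk⇔
      (λ le → ℤ.drop‿+≤+ (subst (ℤ._≤ + (size s + N)) lhs (ℤ.+-monoˡ-≤ (+ N) le)))
      (λ le → ℤ.≤-trans (ℤ.≤-reflexive (cancel _)) (ℤ.≤-trans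
         (ℤ.+-monoˡ-≤ (ℤ.- + N) (subst (ℤ._≤ + (size s + N)) (sym lhs) (ℤ.+≤+ le))) (ℤ.≤-reflexive (sym (cancel _)))))
      where
      open ℤ-Solver
      cancel : ∀ x → x ≡ x ℤ.+ + N ℤ.+ ℤ.- + N
      cancel x = solve 2 (λ x c → x := x :+ c :+ (:- c)) refl x (+ N)
      lhs : + N ℤ.* (+ l ℤ.- 1ℤ) ℤ.+ + N ≡ + (N * l)
      lhs = trans (solve 2 (λ N l → N :* (l :- con 1ℤ) :+ N := N :* l) refl (+ N) (+ l)) (sym (ℤ.pos-* N l))

    -- One has N (w - 1) + v ≥ α, with equality for a single term and because of α ≤ N for more
    -- terms. The gap is therefore at least N χ, hence at least χ, which is the listing order.
    gap⇒≻ : ∀ t → Gap a N s t → s ≻ t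
    gap⇒≻ t gap = χ⇒≻ s t (ℕ.≤-trans
      (subst (ℕ._≤ N * χℕ t + size t) (ℕ.+-comm (χℕ t) (size t)) (ℕ.+-monoˡ-≤ (size t) (ℕ.m≤n*m (χℕ t) N)))
      (ℕ.+-cancelˡ-≤ (α + N) _ _ (begin
        (α + N) + (N * χℕ t + size t)         ≤⟨ ℕ.+-monoˡ-≤ _ (α+N≤ L b) ⟩
        (N * l + â p) + (N * χℕ t + size t)   ≡⟨ solve 5 (λ N l h x t → (N :* l :+ h) :+ (N :* x :+ t) := N :* (l :+ x) :+ h :+ t) refl N l (â p) (χℕ t) (size t) ⟩
        N * (l + χℕ t) + â p + size t         ≤⟨ Equivalence.to (gap⇔ t) gap ⟩
        size s + α + N                        ≡⟨ solve 3 (λ s α N → s :+ α :+ N := (α :+ N) :+ s) refl (size s) α N ⟩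
        (α + N) + size s                      ∎)))
      where
      open ℕ.≤-Reasoning
      open +-*-Solver
      α+N≤ : ∀ L → Block (p ∷ L) → Σâ (p ∷ L) + N ℕ.≤ N * length (p ∷ L) + â p
      α+N≤ [] _ = ℕ.≤-reflexive (solve 2 (λ N h → (h :+ con 0) :+ N := N :* con 1 :+ h) refl N (â p))
      α+N≤ (q ∷ L) b = begin
        Σâ (p ∷ q ∷ L) + N                  ≤⟨ ℕ.+-monoˡ-≤ N (Σâ≤N b) ⟩
        N + N                               ≤⟨ ℕ.m≤m+n (N + N) _ ⟩
        N + N + (N * length L + â p)        ≡⟨ solve 3 (λ N l h → N :+ N :+ (N :* l :+ h) := N :* (con 2 :+ l) :+ h) refl N (length L) (â p) ⟩
        N * length (p ∷ q ∷ L) + â p        ∎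

  -- Layouts and the overpartitions counted by G.

  module _ (n k : ℕ) where
    open Words N ρ 1≤ρ ρ≤N ρ-anti n k

    part-quotient : ∀ {S l M} → Block S → l + Σâ S ≡ N * M → e + length S ℕ.≤ M →
                    l ≡ N * (M ℕ.∸ (e + length S)) + residues S
    part-quotient {S} {l} {M} b eq le = ℕ.+-cancelʳ-≡ (Σâ S) _ _ (begin
      l + Σâ S                                  ≡⟨ eq ⟩
      N * M                                     ≡⟨ cong (N *_) (sym (ℕ.m∸n+n≡m le)) ⟩
      N * (M ℕ.∸ c + c)                         ≡⟨ ℕ.*-distribˡ-+ N (M ℕ.∸ c) c ⟩
      N * (M ℕ.∸ c) + N * c                     ≡⟨ cong (λ z → N * (M ℕ.∸ c) + z) (sym (residues+Σâ b)) ⟩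
      N * (M ℕ.∸ c) + (residues S + Σâ S)       ≡⟨ sym (ℕ.+-assoc (N * (M ℕ.∸ c)) (residues S) (Σâ S)) ⟩
      N * (M ℕ.∸ c) + residues S + Σâ S         ∎)
      where
      open ≡-Reasoning
      c = e + length S

    part+Σâ : ∀ {S} x → Block S → N * x + residues S + Σâ S ≡ N * (x + (e + length S))
    part+Σâ {S} x b = trans (ℕ.+-assoc (N * x) _ _)
      (trans (cong (λ z → N * x + z) (residues+Σâ b)) (sym (ℕ.*-distribˡ-+ N x _)))

    part∣ : ∀ {S} x → Block S → N ∣ N * x + residues S + Σâ S
    part∣ {S} x b = subst (N ∣_) (sym (part+Σâ x b)) (m∣m*n _)

    1≤residues : ∀ {S} → Block S → 1 ℕ.≤ residues S
    1≤residues {p ∷ _} _ = ℕ.≤-trans (1≤ρ p) (ℕ.m≤m+n (ρ p) _)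

    -- Gap s t in terms of quotients by N, for size s + α = N M with α the sum over S,
    -- and size t = N y + ρ(T).
    Separated : ∀ (S T : List (Fin r)) (t : Part) (y M : ℕ) → Set
    Separated S T t y M = (y + χℕ t) + (jump S T + pred (length T)) + (e + length S) ℕ.≤ M

    module _ {p : Fin r} {L T : List (Fin r)} (bS : Block (p ∷ L)) (bT : Block T) (s : Part) {o : Bool} (y M : ℕ)
             (eq : size s + Σâ (p ∷ L) ≡ N * M) where
      private
        open +-*-Solver
        t = part (N * y + residues T) o
        d : N ∣ size s + Σâ (p ∷ L)
        d = subst (N ∣_) (sym eq) (m∣m*n M)
        l = length (p ∷ L)
        X = l + χℕ t + (y + (e + length T))
        lhs : N * (l + χℕ t) + â p + size t + Σâ T ≡ N * X + â p
        lhs = trans (ℕ.+-assoc (N * (l + χℕ t) + â p) (size t) (Σâ T)) (trans (cong (λ z → N * (l + χℕ t) + â p + z) (part+Σâ y bT))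
          (solve 4 (λ N a h b → N :* a :+ h :+ N :* b := N :* (a :+ b) :+ h) refl N (l + χℕ t) (â p) (y + (e + length T))))
        rhs : size s + Σâ (p ∷ L) + N + Σâ T ≡ N * suc M + Σâ T
        rhs = cong (_+ Σâ T) (trans (cong (_+ N) eq) (trans (ℕ.+-comm (N * M) N) (sym (ℕ.*-suc N M))))
        rearrange : ∀ T → Block T → l + χℕ t + (y + (e + length T)) + jump (p ∷ L) T
                    ≡ suc ((y + χℕ t) + (jump (p ∷ L) T + pred (length T)) + (e + length (p ∷ L)))
        rearrange T@(_ ∷ T′) _ = solve 6 (λ l x y e t j →
            l :+ x :+ (y :+ (e :+ (con 1 :+ t))) :+ j := con 1 :+ ((y :+ x) :+ (j :+ t) :+ (e :+ l))) refl
            l (χℕ t) y e (length T′) (jump (p ∷ L) T)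

      -- Adding the sum over `T` turns the two sides into N X + a(p) and N (M + 1) plus that sum, so
      -- `jump` is the carry between X and M + 1. The 1 cancels against the one in |T| = 1 +
      -- `pred (length T)`.
      gap⇒separated : Gap a N s t → Separated (p ∷ L) T t y M
      gap⇒separated gap = ℕ.s≤s⁻¹ (subst (ℕ._≤ suc M) (rearrange T bT)
        (jump-Σâ⁺ {L = L} {X = X} {Y = suc M} bT (subst₂ ℕ._≤_ lhs rhs (ℕ.+-monoˡ-≤ (Σâ T) (Equivalence.to (gap⇔ bS s d t) gap)))))

      separated⇒gap : Separated (p ∷ L) T t y M → Gap a N s t
      separated⇒gap sep = Equivalence.from (gap⇔ bS s d t) (ℕ.+-cancelʳ-≤ (Σâ T) _ _
        (subst₂ ℕ._≤_ (sym lhs) (sym rhs) (jump-Σâ⁻ {L = L} {X = X} {Y = suc M} bT (subst (ℕ._≤ suc M) (sym (rearrange T bT)) (s≤s sep)))))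

    multiple : ∀ {l} → N ∣ l → ∃[ M ] l ≡ N * M
    multiple (divides M eq) = M , trans eq (ℕ.*-comm M N)

    -- The quotient xⱼ of the last part is M - (e + |S|), and this shows that it does not go below
    -- 0. For e = 1 the block is a single index with a(p) = N, and l ≥ 1 yields M ≥ 2.
    lastBound⇒quotient : ∀ {S l M} → Block S → 1 ℕ.≤ l → l + Σâ S ≡ N * M → N * length S ℕ.≤ l + N →
                         e + length S ℕ.≤ M
    lastBound⇒quotient {S} {l} {M} b 1≤l eq le = helper S b eq le (proj₂ slack)
      where
      open ℕ.≤-Reasoning
      helper : ∀ S {e} → Block S → l + Σâ S ≡ N * M → N * length S ℕ.≤ l + N → Slack e → e + length S ℕ.≤ M
      helper S b eq le (none _) = ℕ.s≤s⁻¹ (quotient-< N {x = length S} {y = suc M} (1≤Σâ b) (begin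
        N * length S + Σâ S   ≤⟨ ℕ.+-monoˡ-≤ (Σâ S) le ⟩
        l + N + Σâ S          ≡⟨ solve 3 (λ l N α → l :+ N :+ α := N :+ (l :+ α)) refl l N (Σâ S) ⟩
        N + (l + Σâ S)        ≡⟨ cong (_+_ N) eq ⟩
        N + N * M             ≡⟨ sym (trans (ℕ.+-identityʳ _) (ℕ.*-suc N M)) ⟩
        N * suc M + 0         ∎))
        where open +-*-Solver
      helper (p ∷ []) b eq le (full â≡N _) = quotient-< N {x = 1} {y = M} 1≤l (begin
        N * 1 + l             ≡⟨ solve 2 (λ N l → N :* con 1 :+ l := l :+ (N :+ con 0)) refl N l ⟩
        l + (N + 0)           ≡⟨ cong (λ h → l + (h + 0)) (sym (â≡N p)) ⟩
        l + Σâ (p ∷ [])       ≡⟨ trans eq (sym (ℕ.+-identityʳ _)) ⟩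
        N * M + 0             ∎)
        where open +-*-Solver
      helper (p ∷ q ∷ _) ((p<q ∷ _) ∷ _) eq le (full _ ≮) = contradiction p<q (≮ p q)

    quotient⇒lastBound : ∀ {S} x → Block S → N * length S ℕ.≤ N * x + residues S + N
    quotient⇒lastBound {S} x b = begin
      N * length S                ≤⟨ ℕ.*-monoʳ-≤ N (ℕ.m≤n+m (length S) e) ⟩
      N * (e + length S)          ≡⟨ sym (residues+Σâ b) ⟩
      residues S + Σâ S           ≤⟨ ℕ.+-mono-≤ (ℕ.m≤n+m (residues S) (N * x)) (Σâ≤N (block-increasing b)) ⟩
      N * x + residues S + N      ∎
      where open ℕ.≤-Reasoning

    Last : List Part → Set
    Last qs = ∀ p → last qs ≡ just p → LastBound a N p

    -- The list is decoded from its end, since cⱼ depends on the blocks from j on. Each value is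
    -- what remains of the quotient after subtracting cⱼ.
    decode : ∀ qs → All (λ q → -A′[_] a N (size q)) qs → Linked (Gap a N) qs → Last qs →
             ∃[ B ] ∃[ V ] (All Block B × length V ≡ length B × Linked _≻_ V × build B V ≡ qs)
    decode [] [] [] _ = [] , [] , [] , refl , [] , refl
    decode (part l o ∷ []) (A′l@(1≤l , _) ∷ []) [-] lb
      with S@(_ ∷ _) , b , d ← A′⇒block A′l
      with M , eq ← multiple d =
      [ S ] , [ part (M ℕ.∸ (e + length S)) o ] , b ∷ [] , refl , [-] ,
      cong (λ l → [ part l o ]) (sym (trans
        (part-quotient b eq (lastBound⇒quotient b 1≤l eq
          (Equivalence.to (lastBound⇔ b (part l o) d) (lb _ refl))))
        (cong (λ x → N * x + residues S) (sym (ℕ.+-identityʳ _)))))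
    decode (part l o ∷ q ∷ qs) (A′l ∷ A′s) (gap ∷ gaps) lb
      with T ∷ B , part y o′ ∷ V , bT ∷ bs , len , ls , refl ← decode (q ∷ qs) A′s gaps lb
      with S@(_ ∷ _) , bS , d ← A′⇒block A′l
      with M , eq ← multiple d =
      S ∷ T ∷ B , part u o ∷ part y o′ ∷ V , bS ∷ bT ∷ bs , cong suc len ,
      χ⇒≻ (part u o) (part y o′) y+χ≤u ∷ ls ,
      cong (λ l → part l o ∷ build (T ∷ B) (part y o′ ∷ V))
        (sym (trans (part-quotient bS eq e+l≤M) (cong (λ x → N * x + residues S) (sym (ℕ.m∸n+n≡m F≤X)))))
      where
      open +-*-Solver
      F = offset (S ∷ T ∷ B)
      X = M ℕ.∸ (e + length S)
      u = X ℕ.∸ F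
      -- The jump and length terms of the gap and the offset of the next part add up to `F`. What is
      -- left of the gap is y + χ ≤ u, the order `_≻_` of the values.
      bound : (y + χℕ (part y o′) + F) + (e + length S) ℕ.≤ M
      bound = subst (ℕ._≤ M)
        (solve 5 (λ y f x j c → (y :+ f :+ x) :+ j :+ c := (y :+ x :+ (j :+ f)) :+ c) refl
          y (offset (T ∷ B)) (χℕ (part y o′)) (jump S T + pred (length T)) (e + length S))
        (gap⇒separated bS bT (part l o) {o′} (y + offset (T ∷ B)) M eq gap)
      e+l≤M : e + length S ℕ.≤ M
      e+l≤M = ℕ.m+n≤o⇒n≤o (y + χℕ (part y o′) + F) bound
      y+χ+F≤X : y + χℕ (part y o′) + F ℕ.≤ X
      y+χ+F≤X = ℕ.m+n≤o⇒m≤o∸n (y + χℕ (part y o′) + F) bound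
      F≤X : F ℕ.≤ X
      F≤X = ℕ.m+n≤o⇒n≤o (y + χℕ (part y o′)) y+χ+F≤X
      y+χ≤u : y + χℕ (part y o′) ℕ.≤ u
      y+χ≤u = ℕ.m+n≤o⇒m≤o∸n (y + χℕ (part y o′)) y+χ+F≤X

    build-A′ : ∀ B V → All Block B → All (λ q → -A′[_] a N (size q)) (build B V)
    build-A′ [] _ _ = []
    build-A′ (_ ∷ _) [] _ = []
    build-A′ (S ∷ B) (part v o ∷ V) (b ∷ bs) =
      block⇒A′ (ℕ.≤-trans (1≤residues b) (ℕ.m≤n+m _ _)) b (part∣ (v + offset (S ∷ B)) b) ∷ build-A′ B V bs

    build-gaps : ∀ B V → All Block B → Linked _≻_ V → Linked (Gap a N) (build B V)
    build-gaps [] _ _ _ = []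
    build-gaps (_ ∷ _) [] _ _ = []
    build-gaps (_ ∷ []) (_ ∷ []) _ _ = [-]
    build-gaps (_ ∷ []) (_ ∷ _ ∷ _) _ _ = [-]
    build-gaps (_ ∷ _ ∷ _) (_ ∷ []) _ _ = [-]
    build-gaps (S@(_ ∷ _) ∷ T ∷ B) (part v o ∷ part y o′ ∷ V) (bS ∷ bT ∷ bs) (v≻y ∷ ls) =
      separated⇒gap bS bT (part (N * (v + F) + residues S) o) {o′} (y + offset (T ∷ B)) _ (part+Σâ (v + F) bS)
        (subst (ℕ._≤ v + F + (e + length S))
          (solve 5 (λ y f x j c → (y :+ x :+ (j :+ f)) :+ c := (y :+ f :+ x) :+ j :+ c) refl
            y (offset (T ∷ B)) (χℕ (part y o′)) (jump S T + pred (length T)) (e + length S))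
          (ℕ.+-monoˡ-≤ (e + length S) (ℕ.+-monoˡ-≤ F (≻⇒χ (part v o) (part y o′) v≻y))))
      ∷ build-gaps (T ∷ B) (part y o′ ∷ V) (bT ∷ bs) ls
      where
      open +-*-Solver
      F = offset (S ∷ T ∷ B)

    build-last : ∀ B V → All Block B → length V ≡ length B → Last (build B V)
    build-last (S@(_ ∷ _) ∷ []) (part v o ∷ []) (b ∷ []) _ _ refl =
      Equivalence.from (lastBound⇔ b (part (N * (v + 0) + residues S) o) (part∣ (v + 0) b)) (quotient⇒lastBound (v + 0) b)
    build-last (_ ∷ S ∷ B) (part _ _ ∷ part v o ∷ V) (_ ∷ bs) len =
      build-last (S ∷ B) (part v o ∷ V) bs (ℕ.suc-injective len)

    -- Since ρ(S) may exceed N, it cannot be read off as a remainder. Adding the sums over S and T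
    -- to both sides leaves sums in {1,...,N} as remainders, so quotients and sums agree, and
    -- distinctness gives S = T.
    quotient-unique : ∀ {S T x y} → Block S → Block T → N * x + residues S ≡ N * y + residues T → S ≡ T × x ≡ y
    quotient-unique {S} {T} {x} {y} bS bT eq = S≡T , x≡y S≡T
      where
      open +-*-Solver
      X = x + (e + length S)
      Y = y + (e + length T)
      swapped : N * X + Σâ T ≡ N * Y + Σâ S
      swapped = trans (cong (_+ Σâ T) (sym (part+Σâ x bS))) (trans (cong (λ z → z + Σâ S + Σâ T) eq)
        (trans (solve 3 (λ t α β → t :+ α :+ β := t :+ β :+ α) refl (N * y + residues T) (Σâ S) (Σâ T))
          (cong (_+ Σâ S) (part+Σâ y bT))))
      X≡Y : X ≡ Y
      X≡Y = ℕ.≤-antisym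
        (quotient-≤ N (1≤Σâ bT) (Σâ≤N (block-increasing bS)) (ℕ.≤-reflexive swapped))
        (quotient-≤ N (1≤Σâ bS) (Σâ≤N (block-increasing bT)) (ℕ.≤-reflexive (sym swapped)))
      S≡T : S ≡ T
      S≡T = Σâ-injective bS bT
        (sym (ℕ.+-cancelˡ-≡ (N * X) _ _ (trans swapped (cong (λ z → N * z + Σâ S) (sym X≡Y)))))
      x≡y : S ≡ T → x ≡ y
      x≡y refl = ℕ.+-cancelʳ-≡ (e + length S) x y X≡Y

    build-injective : ∀ B V B′ V′ → All Block B → All Block B′ → length V ≡ length B → length V′ ≡ length B′ →
                      build B V ≡ build B′ V′ → B ≡ B′ × V ≡ V′
    build-injective [] [] [] [] _ _ _ _ _ = refl , refl
    build-injective [] [] (_ ∷ _) (part _ _ ∷ _) _ _ _ _ ()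
    build-injective (_ ∷ _) (part _ _ ∷ _) [] [] _ _ _ _ ()
    build-injective (S ∷ B) (part v o ∷ V) (S′ ∷ B′) (part v′ o′ ∷ V′) (b ∷ bs) (b′ ∷ bs′) len len′ eq
      with refl , refl ← build-injective B V B′ V′ bs bs′ (ℕ.suc-injective len) (ℕ.suc-injective len′) (∷-injectiveʳ eq)
      with refl , eq′ ← quotient-unique b b′ (cong size (∷-injectiveˡ eq))
      with refl ← ℕ.+-cancelʳ-≡ (offset (S ∷ B)) v v′ eq′
      with refl ← cong overlined (∷-injectiveˡ eq) = refl , refl

    layout≃G : IsLayout ≃ IsG a N k n
    layout≃G = record
      { _~_ = λ (B , V) qs → build B V ≡ qs
      ; total = λ {(B , V)} (layout bs len l t m) → build B V , record
          { overpartition = linked⇒overpartition (All.map proj₁ (build-A′ B V bs))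
              (gaps⇒linked (build-A′ B V bs) (build-gaps B V bs l)) t
          ; partsFrom = build-A′ B V bs
          ; nonOverlined≡ = trans (nonOverlined-build B V len) m
          ; gaps = build-gaps B V bs l
          ; lastBound = build-last B V bs len } , refl
      ; surjective = surjective′
      ; functional = λ _ _ eq eq′ → trans (sym eq) eq′
      ; injective = λ {(B , V)} {(B′ , V′)} (layout bs len _ _ _) (layout bs′ len′ _ _ _) eq eq′ →
          let B≡ , V≡ = build-injective B V B′ V′ bs bs′ len len′ (trans eq (sym eq′)) in cong₂ _,_ B≡ V≡
      }
      where
      gaps⇒linked : ∀ {qs} → All (λ q → -A′[_] a N (size q)) qs → Linked (Gap a N) qs → Linked _≻_ qs
      gaps⇒linked [] [] = []
      gaps⇒linked (_ ∷ []) [-] = [-]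
      gaps⇒linked {q ∷ q′ ∷ _} (A′q ∷ A′s) (g ∷ gs) with (_ ∷ _) , b , d ← A′⇒block A′q =
        gap⇒≻ b q d q′ g ∷ gaps⇒linked A′s gs
      surjective′ : ∀ {qs} → IsG a N k n qs → ∃[ BV ] (IsLayout BV × build (proj₁ BV) (proj₂ BV) ≡ qs)
      surjective′ g with B , V , bs , len , l , refl ← decode _ (IsG.partsFrom g) (IsG.gaps g) (IsG.lastBound g) =
        (B , V) , layout bs len l (IsOverpartition.sums (IsG.overpartition g))
                    (trans (sym (nonOverlined-build B V len)) (IsG.nonOverlined≡ g)) , refl

    -- Parts from -A and the enumeration of the overpartitions counted by F.

    A⇔colored : ∀ s → -A[_] a N (size s) ⇔ Colored s
    A⇔colored (part l o) = mk⇔ to from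
      where
      open +-*-Solver
      to : -A[_] a N l → Colored (part l o)
      to (1≤l , p , eq) with M , eq′ ← multiple (Equivalence.to (mod⇔∣ {N} {l} {â p})
                                         (subst (λ c → + l ≡ ℤ.- c [mod N ]) (a≡â p) eq)) =
        -- Subtracting ρ(p) + a(p) = N (1 + e) from l + a(p) = N M leaves this quotient.
        (p , part (M ℕ.∸ suc e) o) , cong (λ l → part l o) (sym (ℕ.+-cancelʳ-≡ (â p) _ _ (begin
          l + â p                                ≡⟨ eq′ ⟩
          N * M                                  ≡⟨ cong (N *_) (sym (ℕ.m∸n+n≡m e<M)) ⟩
          N * (M ℕ.∸ suc e + suc e)              ≡⟨ ℕ.*-distribˡ-+ N (M ℕ.∸ suc e) (suc e) ⟩
          N * (M ℕ.∸ suc e) + N * suc e          ≡⟨ cong (λ z → N * (M ℕ.∸ suc e) + z) (sym (ρ+â p)) ⟩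
          N * (M ℕ.∸ suc e) + (ρ p + â p)        ≡⟨ sym (ℕ.+-assoc (N * (M ℕ.∸ suc e)) (ρ p) (â p)) ⟩
          N * (M ℕ.∸ suc e) + ρ p + â p          ∎)))
        where
        open ≡-Reasoning
        -- Because N e ≤ a(p) < l + a(p) = N M, the subtraction in the quotient is not truncated.
        Ne≤â : N * e ℕ.≤ â p
        Ne≤â = ℕ.+-cancelˡ-≤ N _ _ (subst (ℕ._≤ N + â p) (trans (ρ+â p) (ℕ.*-suc N e)) (ℕ.+-monoˡ-≤ (â p) (ρ≤N p)))
        e<M : e ℕ.< M
        e<M = quotient-< N {u = l} 1≤l (subst (N * e + l ℕ.≤_) (trans (ℕ.+-comm (â p) l) (trans eq′ (sym (ℕ.+-identityʳ _))))
                (ℕ.+-monoˡ-≤ l Ne≤â))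
      from : Colored (part l o) → -A[_] a N l
      from ((p , part t o) , refl) =
        ℕ.≤-trans (1≤ρ p) (ℕ.m≤n+m (ρ p) (N * t)) , p ,
        subst (λ c → + (N * t + ρ p) ≡ ℤ.- c [mod N ]) (sym (a≡â p))
          (Equivalence.from (mod⇔∣ {N} {N * t + ρ p} {â p}) (subst (N ∣_) (sym (begin
            N * t + ρ p + â p     ≡⟨ ℕ.+-assoc (N * t) (ρ p) (â p) ⟩
            N * t + (ρ p + â p)   ≡⟨ cong (λ z → N * t + z) (ρ+â p) ⟩
            N * t + N * suc e     ≡⟨ sym (ℕ.*-distribˡ-+ N t (suc e)) ⟩
            N * (t + suc e)       ∎)) (m∣m*n _)))
        where open ≡-Reasoning

    F⇔colored : ∀ ps → IsF a N k n ps ⇔ IsColored ps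
    F⇔colored ps = mk⇔
      (λ f → let open IsF f in colored (All.map (Equivalence.to (A⇔colored _)) partsFrom)
        (overpartition⇒linked overpartition) (IsOverpartition.sums overpartition) nonOverlined≡)
      (λ (colored c l t m) → let A = All.map (Equivalence.from (A⇔colored _)) c in record
        { overpartition = linked⇒overpartition (All.map proj₁ A) l t ; partsFrom = A ; nonOverlined≡ = m })

    isF? : ∀ ps → Dec (IsF a N k n ps)
    isF? ps = map′
      (λ (l , c , t , m) → record
        { overpartition = linked⇒overpartition (All.map proj₁ c) l t ; partsFrom = c ; nonOverlined≡ = m })
      (λ f → let open IsF f in
        overpartition⇒linked overpartition , partsFrom , IsOverpartition.sums overpartition , nonOverlined≡)
      (Linked.linked? _≻?_ ps ×-dec
       All.all? (λ p → 1 ℕ.≤? size p ×-dec Fin.any? (λ i → N ∣? ℤ.∣ + size p ℤ.- (ℤ.- a i) ∣)) ps ×-dec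
       total-size ps ℕ.≟ n ×-dec
       nonOverlined ps ℕ.≟ k)
      where
      _≻?_ : ∀ p q → Dec (p ≻ q)
      p ≻? part t false = t ℕ.≤? size p
      p ≻? part t true  = t ℕ.<? size p

    -- Only F is enumerated directly; its count m is carried along the chain of bijections, which
    -- also yields the finiteness of G.
    number-F≡number-G : ∃[ m ] (Number (IsF a N k n) m × Number (IsG a N k n) m)
    number-F≡number-G
      with m , F ← number-⊆ (≡-dec _≟ₚ_) isF? (overpartitionCandidates n)
                     (∈-overpartitionCandidates ∘ IsF.overpartition) =
      m , F , Number-≃ layout≃G (Number-colored⇒layout (Number-⇔ F⇔colored F))

theorem1p6 : (r : ℕ) → 1 ℕ.≤ r →
    (a : Fin r → ℤ) →
    Injective _≡_ _≡_ a →
    (∀ (k : Fin r) → ∑[ i < toℕ k ] a (inject {i = k} i) < a k) →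
    (∀ (S S′ : Subset r) → Nonempty S → Nonempty S′ →
    subsetSum a S ≡ subsetSum a S′ → S ≡ S′) →
    (N : ℕ) .{{_ : NonZero N}} →
    ∑[ i < r ] a i ≤ + N →
    (n k : ℕ) → 1 ℕ.≤ n →
    ∃[ m ] (Number (IsF a N k n) m × Number (IsG a N k n) m)
theorem1p6 r _ a _ superincreasing distinctSums N ∑a≤N n k _ =
  Colours.number-F≡number-G a superincreasing distinctSums N ∑a≤N n k
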